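{- Let $G$ be a connected graph of order $n\ge 7$. Then $\eta_p(G)=n-2$ if and only if $G$ is isomorphic to one of the graphs $H_1,\dots,H_{17}$ defined below.
   Context: All graphs are finite, simple, undirected and connected. For $v\in V(G)$ and $S\subseteq V(G)$, $d(v,S)=\min\{d(v,w):w\in S\}$. For a partition $\Pi=\{S_1,\dots,S_k\}$ of $V(G)$, $r(u|\Pi)=(d(u,S_1),\dots,d(u,S_k))$; $\Pi$ is resolving if $r(u|\Pi)\ne r(v|\Pi)$ for all distinct $u,v$, and dominating if every vertex $v$ satisfies $d(v,S_j)=1$ for some $j$. $\eta_p(G)$ is the minimum cardinality of a partition that is both resolving and dominating. Notation: $K_m$ complete graph, $\overline{K_m}$ edgeless graph on $m$ vertices, $P_m$ path, $C_4$ 4-cycle, $2K_2$ two disjoint edges, $K_{2,n-2}$ complete bipartite, $+$ disjoint union, $\vee$ join. The graphs (all of order $n$): $H_1=K_{n-3}\vee(K_2+K_1)$; $H_2=K_{n-3}\vee\overline{K_3}$; $H_3=K_{n-4}\vee C_4$; $H_4=K_{n-4}\vee P_4$; $H_5=K_{n-4}\vee 2K_2$; $H_6=K_{2,n-2}$; $H_7=\overline{K_{n-2}}\vee K_2$; $H_8=(K_{n-3}+K_1)\vee K_2$; $H_9=(K_{n-3}+K_1)\vee\overline{K_2}$; $H_{10}=(K_{n-3}+K_2)\vee K_1$; $H_{11}$ is obtained from $(K_{n-4}+K_1)\vee P_3$ by deleting the edge joining the vertex of $K_1$ to one end-vertex of $P_3$; $H_{12}=(\overline{K_{n-3}}+K_2)\vee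 K_1$; $H_{13}=(K_{n-3}+\overline{K_2})\vee K_1$; $H_{14}=K_1\vee(K_1+(K_{n-2}-e))$, where $K_{n-2}-e$ is $K_{n-2}$ minus one edge (i.e. a universal vertex $v$, a leaf attached to $v$, and the remaining $n-2$ vertices inducing $K_{n-2}$ minus an edge); $H_{15}$: a clique $Q\cong K_{n-3}$, two nonadjacent vertices $b,c$ each adjacent to all of $Q$, and a vertex $a$ adjacent only to $c$ (this is $H_9$ minus one edge between the $K_1$-vertex and a vertex of $\overline{K_2}$); $H_{16}$: a clique $Q\cong K_{n-3}$, a vertex $x$ adjacent to all of $Q$ and to a vertex $w$, and a vertex $u$ adjacent only to $w$ (this is $H_{10}$ minus an edge from the dominating vertex to a vertex of $K_2$); $H_{17}$: a vertex $c$ adjacent to $n-3$ leaves and to a vertex $b$, and a vertex $a$ adjacent only to $b$ (this is $H_{12}$ minus an edge from the dominating vertex to a vertex of $K_2$). -}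

module Defs where

open import Data.Nat using (ℕ; zero; suc; _≤_; _<_; _∸_; _<ᵇ_; _≡ᵇ_)
open import Data.Bool using (Bool; true; false; _∧_; _∨_; not; if_then_else_)
open import Data.Fin using (Fin; toℕ)
open import Data.Product using (Σ; ∃; ∃-syntax; _×_; _,_)
open import Relation.Binary.PropositionalEquality using (_≡_; _≢_; refl; sym; trans; subst)
open import Data.Bool using (T)
open import Data.Unit using (tt)
open import Data.Empty using (⊥; ⊥-elim)
open import Data.Nat.Properties using (<ᵇ⇒<; <-irrefl; <-asym)
open import Relation.Nullary using (¬_)
open import Function.Bundles using (_↔_; Inverse)

record Graph (n : ℕ) : Set where
  field
    E      : Fin n → Fin n → Bool
    E-sym    : ∀ u v → E u v ≡ E v u
    E-irrefl : ∀ v → E v v ≡ false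
open Graph public

data Walk {n : ℕ} (G : Graph n) : Fin n → Fin n → ℕ → Set where
  here : ∀ {v} → Walk G v v 0
  step : ∀ {u w v k} → E G u w ≡ true → Walk G w v k → Walk G u v (suc k)

Connected : ∀ {n} → Graph n → Set
Connected {n} G = ∀ (u v : Fin n) → ∃[ k ] Walk G u v k

_≅_ : ∀ {n} → Graph n → Graph n → Set
_≅_ {n} G H = Σ (Fin n ↔ Fin n) λ f →
  ∀ u v → E G u v ≡ E H (Inverse.to f u) (Inverse.to f v)

record Partition (n k : ℕ) : Set where
  field
    cls  : Fin n → Fin k
    surj : ∀ (j : Fin k) → ∃[ v ] cls v ≡ j
open Partition public

DistTo : ∀ {n k} → Graph n → Partition n k → Fin n → Fin k → ℕ → Set
DistTo {n} G P v j d =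
  (∃[ w ] (cls P w ≡ j × Walk G v w d)) ×
  (∀ (w : Fin n) (d' : ℕ) → cls P w ≡ j → Walk G v w d' → d ≤ d')

Resolving : ∀ {n k} → Graph n → Partition n k → Set
Resolving {n} {k} G P = ∀ (u v : Fin n) → u ≢ v →
  ∃[ j ] ∃[ d₁ ] ∃[ d₂ ] (DistTo G P u j d₁ × DistTo G P v j d₂ × d₁ ≢ d₂)

Dominating : ∀ {n k} → Graph n → Partition n k → Set
Dominating {n} {k} G P = ∀ (v : Fin n) → ∃[ j ] DistTo G P v j 1

ResDomPartition : ∀ {n} → Graph n → ℕ → Set
ResDomPartition {n} G k = Σ (Partition n k) λ P → Resolving G P × Dominating G P

ηp≡ : ∀ {n} → Graph n → ℕ → Set
ηp≡ G m = ResDomPartition G m × (∀ k → k < m → ¬ ResDomPartition G k)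

mkE : ∀ {n} → (ℕ → ℕ → Bool) → Fin n → Fin n → Bool
mkE e u v = if toℕ u <ᵇ toℕ v then e (toℕ u) (toℕ v)
            else if toℕ v <ᵇ toℕ u then e (toℕ v) (toℕ u) else false

private
  lt-irr : ∀ m → (m <ᵇ m) ≡ false
  lt-irr m with m <ᵇ m in eq
  ... | false = refl
  ... | true = ⊥-elim (<-irrefl refl (<ᵇ⇒< m m (subst T (sym eq) tt)))

  lt-asym : ∀ a b → (a <ᵇ b) ≡ true → (b <ᵇ a) ≡ false
  lt-asym a b p with b <ᵇ a in eq
  ... | false = refl
  ... | true = ⊥-elim (<-asym (<ᵇ⇒< a b (subst T (sym p) tt))
                              (<ᵇ⇒< b a (subst T (sym eq) tt)))

mkE-irrefl : ∀ {n} (e : ℕ → ℕ → Bool) (v : Fin n) → mkE e v v ≡ false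
mkE-irrefl e v rewrite lt-irr (toℕ v) = refl

mkE-sym : ∀ {n} (e : ℕ → ℕ → Bool) (u v : Fin n) → mkE e u v ≡ mkE e v u
mkE-sym e u v with toℕ u <ᵇ toℕ v in p | toℕ v <ᵇ toℕ u in q
... | true  | true  = ⊥-elim (clash (trans (sym q) (lt-asym (toℕ u) (toℕ v) p)))
  where clash : true ≡ false → ⊥
        clash ()
... | true  | false = refl
... | false | true  = refl
... | false | false = refl

mkGraph : (n : ℕ) → (ℕ → ℕ → Bool) → Graph n
mkGraph n e = record { E = mkE e ; E-sym = mkE-sym e ; E-irrefl = mkE-irrefl e }

-- The graphs H_1, ..., H_17 of order n (vertices labelled 0 .. n-1;
-- the edge rule e i j is only consulted for i < j)

_≥ᵇ_ : ℕ → ℕ → Bool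
a ≥ᵇ b = not (a <ᵇ b)

H : ℕ → (n : ℕ) → Graph n
-- H1 = K_{n-3} ∨ (K_2 + K_1): clique 0..n-4, K_2 = {n-3,n-2}, K_1 = {n-1}
H 1 n = mkGraph n λ i j → (i <ᵇ (n ∸ 3)) ∨ ((i ≡ᵇ (n ∸ 3)) ∧ (j ≡ᵇ (n ∸ 2)))
-- H2 = K_{n-3} ∨ complement(K_3)
H 2 n = mkGraph n λ i j → i <ᵇ (n ∸ 3)
-- H3 = K_{n-4} ∨ C_4 : cycle (n-4)(n-3)(n-2)(n-1)
H 3 n = mkGraph n λ i j → (i <ᵇ (n ∸ 4)) ∨ (j ≡ᵇ suc i) ∨ ((i ≡ᵇ (n ∸ 4)) ∧ (j ≡ᵇ (n ∸ 1)))
-- H4 = K_{n-4} ∨ P_4 : path (n-4)(n-3)(n-2)(n-1)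
H 4 n = mkGraph n λ i j → (i <ᵇ (n ∸ 4)) ∨ (j ≡ᵇ suc i)
-- H5 = K_{n-4} ∨ 2K_2 : edges (n-4,n-3), (n-2,n-1)
H 5 n = mkGraph n λ i j → (i <ᵇ (n ∸ 4)) ∨ ((i ≡ᵇ (n ∸ 4)) ∧ (j ≡ᵇ (n ∸ 3)))
                                         ∨ ((i ≡ᵇ (n ∸ 2)) ∧ (j ≡ᵇ (n ∸ 1)))
-- H6 = K_{2,n-2} : parts {0,1} and {2..n-1}
H 6 n = mkGraph n λ i j → (i <ᵇ 2) ∧ (j ≥ᵇ 2)
-- H7 = complement(K_{n-2}) ∨ K_2 : K_2 = {0,1}
H 7 n = mkGraph n λ i j → i <ᵇ 2
-- H8 = (K_{n-3} + K_1) ∨ K_2 : K_2 = {0,1}, K_1 = {2}, clique 3..n-1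
H 8 n = mkGraph n λ i j → (i <ᵇ 2) ∨ (i ≥ᵇ 3)
-- H9 = (K_{n-3} + K_1) ∨ complement(K_2) : {0,1} independent, K_1 = {2}, clique 3..n-1
H 9 n = mkGraph n λ i j → ((i <ᵇ 2) ∧ (j ≥ᵇ 2)) ∨ (i ≥ᵇ 3)
-- H10 = (K_{n-3} + K_2) ∨ K_1 : K_1 = {0}, K_2 = {1,2}, clique 3..n-1
H 10 n = mkGraph n λ i j → (i ≡ᵇ 0) ∨ ((i ≡ᵇ 1) ∧ (j ≡ᵇ 2)) ∨ (i ≥ᵇ 3)
-- H11 : P_3 = 0-1-2, K_1 = {3}, clique 4..n-1; join of P_3 with (K_{n-4}+K_1)
--       minus the edge {0,3}
H 11 n = mkGraph n λ i j → ((j <ᵇ 3) ∧ (j ≡ᵇ suc i))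
                         ∨ ((i <ᵇ 3) ∧ (j ≥ᵇ 3) ∧ not ((i ≡ᵇ 0) ∧ (j ≡ᵇ 3)))
                         ∨ (i ≥ᵇ 4)
-- H12 = (complement(K_{n-3}) + K_2) ∨ K_1 : K_1 = {0}, K_2 = {1,2}
H 12 n = mkGraph n λ i j → (i ≡ᵇ 0) ∨ ((i ≡ᵇ 1) ∧ (j ≡ᵇ 2))
-- H13 = (K_{n-3} + complement(K_2)) ∨ K_1 : K_1 = {0}, {1,2} independent, clique 3..n-1
H 13 n = mkGraph n λ i j → (i ≡ᵇ 0) ∨ (i ≥ᵇ 3)
-- H14 = K_1 ∨ (K_1 + (K_{n-2} - e)) : v = 0, leaf 1, 2..n-1 clique minus edge {2,3}
H 14 n = mkGraph n λ i j → (i ≡ᵇ 0) ∨ ((i ≥ᵇ 2) ∧ not ((i ≡ᵇ 2) ∧ (j ≡ᵇ 3)))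
-- H15 : a = 0, b = 1, c = 2, Q = 3..n-1 ; a~c, b,c ~ all of Q
H 15 n = mkGraph n λ i j → ((i ≡ᵇ 0) ∧ (j ≡ᵇ 2)) ∨ ((i ≥ᵇ 1) ∧ (j ≥ᵇ 3))
-- H16 : x = 0, w = 1, u = 2, Q = 3..n-1 ; x ~ Q, x ~ w, u ~ w
H 16 n = mkGraph n λ i j → ((i ≡ᵇ 0) ∧ not (j ≡ᵇ 2)) ∨ ((i ≡ᵇ 1) ∧ (j ≡ᵇ 2)) ∨ (i ≥ᵇ 3)
-- H17 : c = 0, b = 1, a = 2, leaves 3..n-1 ; c ~ leaves, c ~ b, b ~ a
H 17 n = mkGraph n λ i j → ((i ≡ᵇ 0) ∧ not (j ≡ᵇ 2)) ∨ ((i ≡ᵇ 1) ∧ (j ≡ᵇ 2))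
H _ n = mkGraph n λ _ _ → false

{-# OPTIONS --safe #-}
module Submission where

-- Call a partition of a vertex set W with |W| - d classes a certificate of defect d if vertices of
-- one class differ in the classes they are adjacent to, and every vertex of a non-singleton class
-- has a neighbour in W outside its class.  Adding singletons turns a certificate found in any induced
-- subgraph of a connected graph G into a resolving dominating partition of G with n - d classes.
-- So if η_p(G) = n - 2, no induced subgraph of G has a certificate of defect 3.  Ordering the
-- vertices such that all initial segments are connected, a finite computation leaves 20 non-complete
-- graphs on 7 vertices; each starts a family obtained by enlarging a class of twins, and adding one
-- vertex to a member of a family yields a certificate or the next member of a family.  These
-- families are H_1, ..., H_17 and three families which, like K_n, have η_p > n - 2.
-- Conversely each H_i has a certificate of defect 2.  Since twins lie in different classes, with fewer
-- than n - 2 classes almost every class contains a vertex of the large twin class, and then some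
-- vertex is not resolved from the twin in its class, or some twin is not dominated.

open import Defs
open import Data.Bool using (Bool; true; false; if_then_else_; _∧_; _∨_; not)
open import Data.Bool.Properties using (¬-not) renaming (_≟_ to _≟ᵇ_)
open import Data.Empty using (⊥)
open import Data.Fin using (Fin; toℕ; fromℕ<)
open import Data.Fin.Properties using (any?; injective⇒≤; toℕ-injective; toℕ<n; toℕ-fromℕ<; fromℕ<-injective) renaming (_≟_ to _≟ᶠ_)
open import Data.List using (List; []; _∷_; _++_; map; concatMap; length; applyUpTo; downFrom)
open import Data.List.Relation.Unary.Any as Any using (Any)
open import Data.List.Relation.Unary.Any.Properties using (applyUpTo⁺)
open import Data.Nat using (ℕ; zero; suc; _+_; _∸_; _⊓_; _/_; _%_; _^_; _≤_; _<_; _≤?_; _<?_; _≡ᵇ_; _<ᵇ_; z≤n; s≤s; s≤s⁻¹; s<s⁻¹)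
open import Data.Nat.Properties
open import Data.Product using (∃-syntax; _×_; _,_; proj₁; proj₂)
open import Data.Sum using (_⊎_; inj₁; inj₂; [_,_]′)
open import Function using (_∘_; id)
open import Function.Bundles using (_⇔_; mk⇔; Inverse; mk↔ₛ′)
open import Relation.Binary.Definitions using (tri<; tri≈; tri>)
open import Relation.Binary.PropositionalEquality using (_≡_; _≢_; refl; sym; trans; cong; cong₂; subst)
open import Relation.Nullary using (¬_; Dec; yes; no; contradiction)
open import Relation.Nullary.Decidable using (map′; _×-dec_; _⊎-dec_; _→-dec_; ¬?; does; does-⇔; True; toWitness)
open import Relation.Unary using (Decidable)

-- Injections of initial segments of ℕ

-- Vertex sequences are total on `ℕ` and constrained only below a bound, so that indices can be
-- shifted, clamped and permuted without casts between finite types.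
InjBelow : {A : Set} → ℕ → (ℕ → A) → Set
InjBelow m f = ∀ {i j} → i < m → j < m → f i ≡ f j → i ≡ j

injBelow⇒≤ : ∀ {k m} (f : ℕ → Fin k) → InjBelow m f → m ≤ k
injBelow⇒≤ f f-inj =
  injective⇒≤ {f = f ∘ toℕ} λ {i} {j} → toℕ-injective ∘ f-inj (toℕ<n i) (toℕ<n j)

infixr 5 _◂_
_◂_ : {A : Set} → A → (ℕ → A) → ℕ → A
(a ◂ f) zero    = a
(a ◂ f) (suc i) = f i

◂-injBelow : ∀ {A : Set} {m} {v : A} (f : ℕ → A) → InjBelow m f →
  (∀ {i} → i < m → f i ≢ v) → InjBelow (suc m) (v ◂ f)
◂-injBelow f f-inj f≢v {zero}  {zero}  _ _ _ = refl
◂-injBelow f f-inj f≢v {zero}  {suc j} _ q e = contradiction (sym e) (f≢v (s<s⁻¹ q))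
◂-injBelow f f-inj f≢v {suc i} {zero}  p _ e = contradiction e (f≢v (s<s⁻¹ p))
◂-injBelow f f-inj f≢v {suc i} {suc j} p q e = cong suc (f-inj (s<s⁻¹ p) (s<s⁻¹ q) e)

hit? : ∀ {k} m (f : ℕ → Fin k) v → Dec (∃[ i ] (i < m × f i ≡ v))
hit? m f v = anyUpTo? (λ i → f i ≟ᶠ v) m

abstract
  -- A missed value could be prepended to `f`, giving `suc m` distinct elements of `Fin k`.
  injBelow⇒surjective : ∀ {k m} (f : ℕ → Fin k) → InjBelow m f → k ≤ m →
    ∀ v → ∃[ i ] (i < m × f i ≡ v)
  injBelow⇒surjective {m = m} f f-inj k≤m v with hit? m f v
  ... | yes h = h
  ... | no ¬h = contradiction
    (injBelow⇒≤ (v ◂ f) (◂-injBelow f f-inj λ i<m e → ¬h (_ , i<m , e))) (<⇒≱ (s≤s k≤m))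

  -- If every vertex were hit, choosing an index for each would inject `Fin k` into `Fin m`.
  fresh : ∀ {k m} (f : ℕ → Fin k) → m < k → ∃[ v ] (∀ {i} → i < m → f i ≢ v)
  fresh {k} {m} f m<k with any? (λ v → ¬? (hit? m f v))
  ... | yes (v , ¬h) = v , λ i<m e → ¬h (_ , i<m , e)
  ... | no ¬fresh = contradiction (injective⇒≤ {f = pos} pos-inj) (<⇒≱ m<k)
    where
    hits : ∀ v → ∃[ i ] (i < m × f i ≡ v)
    hits v with hit? m f v
    ... | yes h = h
    ... | no ¬h = contradiction (v , ¬h) ¬fresh
    pos : Fin k → Fin m
    pos v = fromℕ< (proj₁ (proj₂ (hits v)))
    pos-inj : ∀ {u v} → pos u ≡ pos v → u ≡ v
    pos-inj {u} {v} e = trans (sym (proj₂ (proj₂ (hits u))))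
      (trans (cong f (fromℕ<-injective _ _ _ _ e)) (proj₂ (proj₂ (hits v))))

  snoc : {A : Set} → ℕ → (ℕ → A) → A → ℕ → A
  snoc m f v i with i ≟ m
  ... | yes _ = v
  ... | no  _ = f i

  snoc-< : ∀ {A : Set} {m} (f : ℕ → A) v {i} → i < m → snoc m f v i ≡ f i
  snoc-< {m = m} f v {i} i<m with i ≟ m
  ... | yes i≡m = contradiction i≡m (<⇒≢ i<m)
  ... | no  _   = refl

  snoc-≡ : ∀ {A : Set} m (f : ℕ → A) v → snoc m f v m ≡ v
  snoc-≡ m f v with m ≟ m
  ... | yes _  = refl
  ... | no m≢m = contradiction refl m≢m

  snoc-injBelow : ∀ {k m} {v : Fin k} (f : ℕ → Fin k) → InjBelow m f →
    (∀ {i} → i < m → f i ≢ v) → InjBelow (suc m) (snoc m f v)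
  snoc-injBelow {m = m} {v} f f-inj f≢v i≤m j≤m e
    with m≤n⇒m<n∨m≡n (s≤s⁻¹ i≤m) | m≤n⇒m<n∨m≡n (s≤s⁻¹ j≤m)
  ... | inj₁ i<m  | inj₁ j<m  = f-inj i<m j<m (trans (sym (snoc-< f v i<m)) (trans e (snoc-< f v j<m)))
  ... | inj₁ i<m  | inj₂ refl = contradiction (trans (sym (snoc-< f v i<m)) (trans e (snoc-≡ m f v))) (f≢v i<m)
  ... | inj₂ refl | inj₁ j<m  = contradiction (trans (sym (snoc-< f v j<m)) (trans (sym e) (snoc-≡ m f v))) (f≢v j<m)
  ... | inj₂ refl | inj₂ refl = refl

  enumerate : ∀ {k} d m (f : ℕ → Fin k) → d + m ≡ k → InjBelow m f →
    ∃[ g ] (InjBelow k g × (∀ {i} → i < m → g i ≡ f i))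
  enumerate zero    m f refl f-inj = f , f-inj , λ _ → refl
  enumerate (suc d) m f e    f-inj with fresh {m = m} f (subst (m <_) e (s≤s (m≤n+m m d)))
  ... | v , f≢v with enumerate d (suc m) (snoc m f v) (trans (+-suc d m) e) (snoc-injBelow f f-inj f≢v)
  ... | g , g-inj , g≡ = g , g-inj , λ i<m → trans (g≡ (m<n⇒m<1+n i<m)) (snoc-< f v i<m)

-- Distances to the classes of a partition

least : ∀ {P : ℕ → Set} → Decidable P → ∀ {k} → P k →
  ∃[ d ] (P d × (∀ {d′} → P d′ → d ≤ d′))
least {P} P? {k} Pk = go k 0 (λ ()) (+-identityʳ k)
  where
  go : ∀ r d → (∀ {d′} → d′ < d → ¬ P d′) → r + d ≡ k → ∃[ d ] (P d × (∀ {d′} → P d′ → d ≤ d′))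
  go r d below e with P? d
  ... | yes Pd = d , Pd , λ Pd′ → ≮⇒≥ λ d′<d → below d′<d Pd′
  go zero    d below e | no ¬Pd = contradiction (subst P (sym e) Pk) ¬Pd
  go (suc r) d below e | no ¬Pd = go r (suc d) below′ (trans (+-suc r d) e)
    where
    below′ : ∀ {d′} → d′ < suc d → ¬ P d′
    below′ d′≤d Pd′ with m≤n⇒m<n∨m≡n (s≤s⁻¹ d′≤d)
    ... | inj₁ d′<d = below d′<d Pd′
    ... | inj₂ refl = ¬Pd Pd′

module _ {n} (G : Graph n) where

  walk? : ∀ u v d → Dec (Walk G u v d)
  walk? u v zero    = map′ (λ { refl → here }) (λ { here → refl }) (u ≟ᶠ v)
  walk? u v (suc d) = map′ (λ (_ , e , p) → step e p) (λ { (step e p) → _ , e , p })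
    (any? λ w → (E G u w ≟ᵇ true) ×-dec walk? w v d)

  module _ {k} (P : Partition n k) where

    AdjTo : Fin n → Fin k → Set
    AdjTo v j = ∃[ w ] (E G v w ≡ true × cls P w ≡ j)

    distTo : Connected G → ∀ v j → ∃[ d ] DistTo G P v j d
    distTo conn v j with surj P j
    ... | w₀ , w₀∈j with least (λ d → any? λ w → (cls P w ≟ᶠ j) ×-dec walk? v w d) (w₀ , w₀∈j , proj₂ (conn v w₀))
    ... | d , Pd , d-min = d , Pd , λ w d′ w∈j p → d-min (w , w∈j , p)

    distTo-0 : ∀ {v j} → DistTo G P v j 0 → cls P v ≡ j
    distTo-0 ((_ , v∈j , here) , _) = v∈j

    distTo-own : ∀ v {j} → cls P v ≡ j → DistTo G P v j 0
    distTo-own v v∈j = (v , v∈j , here) , λ _ _ _ _ → z≤n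

    distTo-1⁻ : ∀ {v j} → DistTo G P v j 1 → AdjTo v j
    distTo-1⁻ ((w , w∈j , step e here) , _) = w , e , w∈j

    distTo-1 : ∀ {v j} → cls P v ≢ j → AdjTo v j → DistTo G P v j 1
    distTo-1 v∉j (w , e , w∈j) = (w , w∈j , step e here) , λ where
      _ zero    v∈j here → contradiction v∈j v∉j
      _ (suc _) _   _    → s≤s z≤n

    distTo-2 : ∀ {v w j} → cls P v ≢ j → ¬ AdjTo v j → E G v w ≡ true → AdjTo w j → DistTo G P v j 2
    distTo-2 v∉j ¬v~j e (x , e′ , x∈j) = (x , x∈j , step e (step e′ here)) , λ where
      _ zero          v∈j  here          → contradiction v∈j v∉j
      _ (suc zero)    w∈j (step e″ here) → contradiction (_ , e″ , w∈j) ¬v~j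
      _ (suc (suc _)) _   _              → s≤s (s≤s z≤n)

    distTo-unique : ∀ {v j d d′} → DistTo G P v j d → DistTo G P v j d′ → d ≡ d′
    distTo-unique ((w , w∈j , p) , m) ((w′ , w′∈j , p′) , m′) =
      ≤-antisym (m _ _ w′∈j p′) (m′ _ _ w∈j p)

    distTo-≢ : ∀ {u v j d d′} → DistTo G P u j d → DistTo G P v j d′ →
      cls P u ≢ j → AdjTo u j → ¬ AdjTo v j → d ≢ d′
    distTo-≢ Du Dv u∉j u~j ¬v~j refl with distTo-unique Du (distTo-1 u∉j u~j)
    ... | refl = ¬v~j (distTo-1⁻ Dv)

    -- Vertices of different classes are resolved by the class of the first: one distance is zero,
    -- the other is not. Within a class it suffices that another class is at distance one from
    -- exactly one of the two vertices, so longer distances need not be computed.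
    adjacency⇒resDom : Connected G →
      (∀ {u v} → u ≢ v → cls P u ≡ cls P v → ∃[ j ] (j ≢ cls P u ×
        ((AdjTo u j × ¬ AdjTo v j) ⊎ (AdjTo v j × ¬ AdjTo u j)))) →
      (∀ v → ∃[ w ] (E G v w ≡ true × cls P w ≢ cls P v)) →
      ResDomPartition G k
    adjacency⇒resDom conn separate dominate = P , resolving , dominating
      where
      resolving : Resolving G P
      resolving u v u≢v with cls P u ≟ᶠ cls P v
      ... | no u≁v with distTo conn v (cls P u)
      ... | d , D = cls P u , 0 , d , distTo-own u refl , D , λ { refl → u≁v (sym (distTo-0 D)) }
      resolving u v u≢v | yes u≈v with separate u≢v u≈v
      ... | j , j≢ , u|v with distTo conn u j | distTo conn v j
      ... | d , D | d′ , D′ = j , d , d′ , D , D′ , ≢d u|v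
        where
        ≢d : (AdjTo u j × ¬ AdjTo v j) ⊎ (AdjTo v j × ¬ AdjTo u j) → d ≢ d′
        ≢d (inj₁ (u~j , ¬v~j)) = distTo-≢ D D′ (j≢ ∘ sym) u~j ¬v~j
        ≢d (inj₂ (v~j , ¬u~j)) = distTo-≢ D′ D (λ e → j≢ (trans (sym e) (sym u≈v))) v~j ¬u~j ∘ sym
      dominating : Dominating G P
      dominating v with dominate v
      ... | w , e , w≁v = cls P w , distTo-1 (w≁v ∘ sym) (w , e , refl)

    -- A resolving class is neither the common class, at distance zero from both vertices, nor
    -- adjacent to both. The conclusion is negative so that a refutation only has to exhibit one
    -- common distance.
    resolvent : Resolving G P → ∀ {u v} → u ≢ v → cls P u ≡ cls P v →
      ∃[ j ] (j ≢ cls P u × ¬ (AdjTo u j × AdjTo v j) ×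
        (∀ {d} → DistTo G P u j d → ¬ DistTo G P v j d))
    resolvent res {u} {v} u≢v u≈v with res u v u≢v
    ... | j , d , d′ , D , D′ , d≢d′ = j , j≢ , ¬both , λ Du Dv → d≢d′ (trans (distTo-unique D Du) (distTo-unique Dv D′))
      where
      j≢ : j ≢ cls P u
      j≢ refl = d≢d′ (trans (distTo-unique D (distTo-own u refl)) (distTo-unique (distTo-own v (sym u≈v)) D′))
      ¬both : ¬ (AdjTo u j × AdjTo v j)
      ¬both (u~j , v~j) = d≢d′ (trans (distTo-unique D (distTo-1 (j≢ ∘ sym) u~j))
        (distTo-unique (distTo-1 (λ e → j≢ (trans (sym e) (sym u≈v))) v~j) D′))

    -- A walk from `u` yields one from `v` that is no longer: its first step either is available
    -- from `v` as well or leads to `v`. If the walk is empty, the target is the common class of `u`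
    -- and `v`.
    twin-dist : ∀ {u v j d w d′} → (∀ x → x ≢ u → x ≢ v → E G u x ≡ E G v x) → cls P u ≡ cls P v →
      DistTo G P v j d → cls P w ≡ j → Walk G u w d′ → d ≤ d′
    twin-dist twin u≈v (_ , min) u∈j here = min _ _ (trans (sym u≈v) u∈j) here
    twin-dist {u} {v} twin u≈v (_ , min) w∈j (step {w = x} e p) with x ≟ᶠ v | x ≟ᶠ u
    ... | yes refl | _        = m≤n⇒m≤1+n (min _ _ w∈j p)
    ... | no _     | yes refl = contradiction (trans (sym e) (E-irrefl G x)) λ ()
    ... | no x≢v   | no x≢u   = min _ _ w∈j (step (trans (sym (twin x x≢u x≢v)) e) p)

    twins-separated : Resolving G P → ∀ {u v} → u ≢ v →
      (∀ x → x ≢ u → x ≢ v → E G u x ≡ E G v x) → cls P u ≢ cls P v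
    twins-separated res {u} {v} u≢v twin u≈v with res u v u≢v
    ... | j , d , d′ , D@((_ , w∈j , p) , _) , D′@((_ , w′∈j , p′) , _) , d≢d′ = d≢d′ (≤-antisym
      (twin-dist (λ x x≢v x≢u → sym (twin x x≢u x≢v)) (sym u≈v) D w′∈j p′)
      (twin-dist twin u≈v D′ w∈j p))

-- Local certificates

all<? : ∀ {P : ℕ → Set} → Decidable P → ∀ m → Dec (∀ i → i < m → P i)
all<? P? zero    = yes λ _ ()
all<? {P} P? (suc m) = map′ to (λ h → h m ≤-refl , λ i → h i ∘ m<n⇒m<1+n) (P? m ×-dec all<? P? m)
  where
  to : P m × (∀ i → i < m → P i) → ∀ i → i < suc m → P i
  to (Pm , h) i i≤m with m≤n⇒m<n∨m≡n (s≤s⁻¹ i≤m)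
  ... | inj₁ i<m  = h i i<m
  ... | inj₂ refl = Pm

any<? : ∀ {P : ℕ → Set} → Decidable P → ∀ m → Dec (∃[ i ] (i < m × P i))
any<? P? zero    = no λ ()
any<? {P} P? (suc m) = map′ to from (P? m ⊎-dec any<? P? m)
  where
  to : P m ⊎ ∃[ i ] (i < m × P i) → ∃[ i ] (i < suc m × P i)
  to (inj₁ Pm)            = m , ≤-refl , Pm
  to (inj₂ (i , i<m , p)) = i , m<n⇒m<1+n i<m , p
  from : ∃[ i ] (i < suc m × P i) → P m ⊎ ∃[ i ] (i < m × P i)
  from (i , i≤m , p) with m≤n⇒m<n∨m≡n (s≤s⁻¹ i≤m)
  ... | inj₁ i<m  = inj₂ (i , i<m , p)
  ... | inj₂ refl = inj₁ p

Adj : Set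
Adj = ℕ → ℕ → Bool

-- The diagonal of `R` is left free; in a blow-up, the diagonal entry at the core tells whether the
-- twins are adjacent to each other.
record Emb {n} (G : Graph n) (m : ℕ) (R : Adj) : Set where
  field
    at     : ℕ → Fin n
    at-inj : InjBelow m at
    at-adj : ∀ {i j} → i < m → j < m → i ≢ j → E G (at i) (at j) ≡ R i j

Touches : ℕ → (ℕ → ℕ) → Adj → ℕ → ℕ → Set
Touches w p R i c = ∃[ t ] (t < w × p t ≡ c × R i t ≡ true)

Distinguished : ℕ → (ℕ → ℕ) → Adj → ℕ → ℕ → Set
Distinguished w p R i j = ∃[ s ] (s < w × p s ≢ p i ×
  ((Touches w p R i (p s) × ¬ Touches w p R j (p s)) ⊎
   (Touches w p R j (p s) × ¬ Touches w p R i (p s))))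

-- Adjacency is tested only against classes other than the vertex's own, so diagonal entries of `R`
-- are never counted as edges. Pairs with `j < i` suffice because distinguishing is symmetric.
record Certificate (w d : ℕ) (p : ℕ → ℕ) (R : Adj) : Set where
  constructor certificate
  field
    distinguishes : ∀ i → i < w → ∀ j → j < i → p i ≡ p j → Distinguished w p R i j
    dominates     : ∀ i → i < w → (∃[ t ] (t < w × p t ≢ p i × R i t ≡ true)) ⊎
                                    (∀ t → t < w → p t ≡ p i → t ≡ i)
    range         : ∀ i → i < w → p i < w ∸ d
    onto          : ∀ c → c < w ∸ d → ∃[ t ] (t < w × p t ≡ c)

touches? : ∀ w p R i c → Dec (Touches w p R i c)
touches? w p R i c = any<? (λ t → (p t ≟ c) ×-dec (R i t ≟ᵇ true)) w

distinguished? : ∀ w p R i j → Dec (Distinguished w p R i j)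
distinguished? w p R i j = any<? (λ s → ¬? (p s ≟ p i) ×-dec
  ((touches? w p R i (p s) ×-dec ¬? (touches? w p R j (p s))) ⊎-dec
   (touches? w p R j (p s) ×-dec ¬? (touches? w p R i (p s))))) w

certificate? : ∀ w d p R → Dec (Certificate w d p R)
certificate? w d p R = map′
  (λ (a , b , c , e) → certificate a b c e)
  (λ C → let open Certificate C in distinguishes , dominates , range , onto)
  (all<? (λ i → all<? (λ j → (p i ≟ p j) →-dec distinguished? w p R i j) i) w
  ×-dec all<? (λ i →
    any<? (λ t → ¬? (p t ≟ p i) ×-dec (R i t ≟ᵇ true)) w ⊎-dec
    all<? (λ t → (p t ≟ p i) →-dec (t ≟ i)) w) w
  ×-dec all<? (λ i → p i <? w ∸ d) w
  ×-dec all<? (λ c → any<? (λ t → p t ≟ c) w) (w ∸ d))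

neighbour : ∀ {n} (G : Graph n) → Connected G → 2 ≤ n → ∀ v → ∃[ w ] E G v w ≡ true
neighbour G conn 2≤n v with fresh {m = 1} (λ _ → v) 2≤n
... | u , v≢u with conn v u
... | _ , here     = contradiction refl (v≢u {0} (s≤s z≤n))
... | _ , step e _ = _ , e

module _ {n} (G : Graph n) (conn : Connected G) (2≤n : 2 ≤ n)
         {w d p R} (emb : Emb G w R) (d≤w : d ≤ w) (C : Certificate w d p R) where

  open Emb emb
  open Certificate C

  private
    w≤n : w ≤ n
    w≤n = injBelow⇒≤ at at-inj

    enum : ∃[ g ] (InjBelow n g × (∀ {i} → i < w → g i ≡ at i))
    enum = enumerate (n ∸ w) w at (m∸n+n≡m w≤n) at-inj

    g : ℕ → Fin n
    g = proj₁ enum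

    g-inj : InjBelow n g
    g-inj = proj₁ (proj₂ enum)

    g-adj : ∀ {i j} → i < w → j < w → i ≢ j → E G (g i) (g j) ≡ R i j
    g-adj i<w j<w i≢j =
      trans (cong₂ (E G) (proj₂ (proj₂ enum) i<w) (proj₂ (proj₂ enum) j<w)) (at-adj i<w j<w i≢j)

    -- The n - w remaining vertices form singleton classes numbered after those of p.
    label : ℕ → ℕ
    label i with i <? w
    ... | yes _ = p i
    ... | no  _ = i ∸ d

    label-< : ∀ {i} → i < w → label i ≡ p i
    label-< {i} i<w with i <? w
    ... | yes _  = refl
    ... | no i≮w = contradiction i<w i≮w

    label-≥ : ∀ {i} → w ≤ i → label i ≡ i ∸ d
    label-≥ {i} w≤i with i <? w
    ... | yes i<w = contradiction w≤i (<⇒≱ i<w)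
    ... | no _    = refl

    label-bound : ∀ {i} → i < n → label i < n ∸ d
    label-bound {i} i<n with <-≤-connex i w
    ... | inj₁ i<w = subst (_< n ∸ d) (sym (label-< i<w)) (<-≤-trans (range _ i<w) (∸-monoˡ-≤ d w≤n))
    ... | inj₂ w≤i = subst (_< n ∸ d) (sym (label-≥ w≤i)) (∸-monoˡ-< i<n (≤-trans d≤w w≤i))

    label-small : ∀ {i} → label i < w ∸ d → i < w
    label-small {i} l with <-≤-connex i w
    ... | inj₁ i<w = i<w
    ... | inj₂ w≤i = contradiction (∸-monoˡ-≤ d w≤i) (<⇒≱ (subst (_< w ∸ d) (label-≥ w≤i) l))

    -- Labels below `w ∸ d` belong to the embedded part, and `i ∸ d` is injective from `w` on; a
    -- repeated label therefore comes from `p`.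
    label-collision : ∀ {i j} → i ≢ j → label i ≡ label j → i < w × j < w × p i ≡ p j
    label-collision {i} {j} i≢j e with <-≤-connex i w | <-≤-connex j w
    ... | inj₁ i<w | _ =
      let j<w = label-small (subst (_< w ∸ d) (trans (sym (label-< i<w)) e) (range _ i<w))
      in i<w , j<w , trans (sym (label-< i<w)) (trans e (label-< j<w))
    ... | inj₂ w≤i | inj₁ j<w =
      contradiction (label-small (subst (_< w ∸ d) (trans (sym (label-< j<w)) (sym e)) (range _ j<w))) (≤⇒≯ w≤i)
    ... | inj₂ w≤i | inj₂ w≤j =
      contradiction (∸-cancelʳ-≡ (≤-trans d≤w w≤i) (≤-trans d≤w w≤j)
        (trans (sym (label-≥ w≤i)) (trans e (label-≥ w≤j)))) i≢j

    hit : ∀ v → ∃[ i ] (i < n × g i ≡ v)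
    hit = injBelow⇒surjective g g-inj ≤-refl

    pos : Fin n → ℕ
    pos v = proj₁ (hit v)

    pos<n : ∀ v → pos v < n
    pos<n v = proj₁ (proj₂ (hit v))

    g-pos : ∀ v → g (pos v) ≡ v
    g-pos v = proj₂ (proj₂ (hit v))

    pos-g : ∀ {i} → i < n → pos (g i) ≡ i
    pos-g {i} i<n = g-inj (pos<n (g i)) i<n (g-pos (g i))

    abstract
      class : Fin n → Fin (n ∸ d)
      class v = fromℕ< (label-bound (pos<n v))

      class-label : ∀ v → toℕ (class v) ≡ label (pos v)
      class-label v = toℕ-fromℕ< _

    class-g : ∀ {i} → i < n → toℕ (class (g i)) ≡ label i
    class-g i<n = trans (class-label _) (cong label (pos-g i<n))

    abstract
      class-onto : ∀ j → ∃[ v ] class v ≡ j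
      class-onto j with <-≤-connex (toℕ j) (w ∸ d)
      ... | inj₁ j< with onto _ j<
      ... | t , t<w , pt≡j = g t , toℕ-injective
        (trans (class-g (<-≤-trans t<w w≤n)) (trans (label-< t<w) pt≡j))
      -- Beyond the classes of `p`, adding `d` inverts the labelling.
      class-onto j | inj₂ j≥ = g (toℕ j + d) , toℕ-injective
        (trans (class-g lt) (trans (label-≥ ge) (m+n∸n≡m (toℕ j) d)))
        where
        ge : w ≤ toℕ j + d
        ge = subst (_≤ toℕ j + d) (m∸n+n≡m d≤w) (+-monoˡ-≤ d j≥)
        lt : toℕ j + d < n
        lt = subst (toℕ j + d <_) (m∸n+n≡m (≤-trans d≤w w≤n)) (+-monoˡ-< d (toℕ<n j))

    Π : Partition n (n ∸ d)
    Π = record { cls = class ; surj = class-onto }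

    class-collision : ∀ u v → u ≢ v → class u ≡ class v →
      pos u ≢ pos v × pos u < w × pos v < w × p (pos u) ≡ p (pos v)
    class-collision u v u≢v e = pu≢pv ,
      label-collision pu≢pv (trans (sym (class-label u)) (trans (cong toℕ e) (class-label v)))
      where
      pu≢pv : pos u ≢ pos v
      pu≢pv q = u≢v (trans (sym (g-pos u)) (trans (cong g q) (g-pos v)))

    touches⇒adjTo : ∀ {i c j} → i < w → c ≢ p i → toℕ j ≡ c → Touches w p R i c → AdjTo G Π (g i) j
    touches⇒adjTo i<w c≢pi j≡c (t , t<w , pt≡c , e) = g t ,
      trans (g-adj i<w t<w λ { refl → c≢pi (sym pt≡c) }) e ,
      toℕ-injective (trans (class-g (<-≤-trans t<w w≤n)) (trans (label-< t<w) (trans pt≡c (sym j≡c))))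

    -- A class with label below `w ∸ d` has no member outside the embedded part, so non-adjacency
    -- read off from `R` persists in `G`.
    adjTo⇒touches : ∀ {i c j} → i < w → c ≢ p i → c < w ∸ d → toℕ j ≡ c → AdjTo G Π (g i) j → Touches w p R i c
    adjTo⇒touches {i} {c} {j} i<w c≢pi c< j≡c (x , e , x∈j) = pos x , px<w , ppx≡c ,
      trans (sym (g-adj i<w px<w λ { refl → c≢pi (sym ppx≡c) })) (trans (cong (E G (g i)) (g-pos x)) e)
      where
      l≡c : label (pos x) ≡ c
      l≡c = trans (sym (class-label x)) (trans (cong toℕ x∈j) j≡c)
      px<w : pos x < w
      px<w = label-small (subst (_< w ∸ d) (sym l≡c) c<)
      ppx≡c : p (pos x) ≡ c
      ppx≡c = trans (sym (label-< px<w)) l≡c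

    Separated : Fin n → Fin n → Fin (n ∸ d) → Set
    Separated u v c = (AdjTo G Π u c × ¬ AdjTo G Π v c) ⊎ (AdjTo G Π v c × ¬ AdjTo G Π u c)

    separate-g : ∀ {i j} → i < w → j < i → p i ≡ p j →
      ∃[ c ] (c ≢ class (g i) × Separated (g i) (g j) c)
    separate-g {i} {j} i<w j<i pi≡pj with distinguishes _ i<w _ j<i pi≡pj
    ... | s , s<w , ps≢pi , alt = class (g s) , c≢ ,
        [ inj₁ ∘ transfer i<w ps≢pi j<w ps≢pj , inj₂ ∘ transfer j<w ps≢pj i<w ps≢pi ]′ alt
      where
      j<w : j < w
      j<w = <-trans j<i i<w
      ps≢pj : p s ≢ p j
      ps≢pj e = ps≢pi (trans e (sym pi≡pj))
      s≡ : toℕ (class (g s)) ≡ p s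
      s≡ = trans (class-g (<-≤-trans s<w w≤n)) (label-< s<w)
      c≢ : class (g s) ≢ class (g i)
      c≢ e = ps≢pi (trans (sym s≡) (trans (cong toℕ e) (trans (class-g (<-≤-trans i<w w≤n)) (label-< i<w))))
      transfer : ∀ {a b} → a < w → p s ≢ p a → b < w → p s ≢ p b →
        Touches w p R a (p s) × ¬ Touches w p R b (p s) →
        AdjTo G Π (g a) (class (g s)) × ¬ AdjTo G Π (g b) (class (g s))
      transfer a<w ps≢pa b<w ps≢pb (ta , ¬tb) =
        touches⇒adjTo a<w ps≢pa s≡ ta , ¬tb ∘ adjTo⇒touches b<w ps≢pb (range _ s<w) s≡

    separate-pos : ∀ u v → pos u < w → pos v < pos u → p (pos u) ≡ p (pos v) →
      ∃[ c ] (c ≢ class u × Separated u v c)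
    separate-pos u v u<w v<u pp =
      subst (λ x → ∃[ c ] (c ≢ class x × Separated x v c)) (g-pos u)
        (subst (λ y → ∃[ c ] (c ≢ class (g (pos u)) × Separated (g (pos u)) y c)) (g-pos v)
          (separate-g {pos u} {pos v} u<w v<u pp))

  -- Two vertices sharing a class both lie in the embedded part, where the certificate separates
  -- them. A vertex alone in its class is dominated through any neighbour, and connectedness
  -- supplies one.
  certificate⇒resDom : ResDomPartition G (n ∸ d)
  certificate⇒resDom = adjacency⇒resDom G Π conn separate dominate
    where
    separate : ∀ {u v} → u ≢ v → class u ≡ class v → ∃[ c ] (c ≢ class u × Separated u v c)
    separate {u} {v} u≢v e = let pu≢pv , u<w , v<w , pp = class-collision u v u≢v e in
      [ (λ v<u → separate-pos u v u<w v<u pp)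
      , (λ u≤v → let c , c≢v , alt = separate-pos v u v<w (≤∧≢⇒< u≤v pu≢pv) (sym pp)
                 in c , (λ c≡u → c≢v (trans c≡u e)) , [ inj₂ , inj₁ ]′ alt)
      ]′ (<-≤-connex (pos v) (pos u))
    alone : ∀ v → (pos v < w → ∀ t → t < w → p t ≡ p (pos v) → t ≡ pos v) →
      ∃[ x ] (E G v x ≡ true × class x ≢ class v)
    alone v single with neighbour G conn 2≤n v
    ... | x , e = x , e , λ q →
      let ne , x< , v< , pp = class-collision x v (λ { refl → contradiction (trans (sym e) (E-irrefl G x)) λ () }) q
      in ne (single v< _ x< pp)
    dominate : ∀ v → ∃[ x ] (E G v x ≡ true × class x ≢ class v)
    dominate v with <-≤-connex (pos v) w
    ... | inj₂ w≤v = alone v λ v<w → contradiction w≤v (<⇒≱ v<w)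
    ... | inj₁ v<w with dominates _ v<w
    ... | inj₂ single = alone v λ _ → single
    ... | inj₁ (t , t<w , pt≢ , e) = g t ,
      trans (cong (λ y → E G y (g t)) (sym (g-pos v))) (trans (g-adj v<w t<w λ { refl → pt≢ refl }) e) ,
      λ q → pt≢ (trans (sym (label-< t<w)) (trans (sym (class-g (<-≤-trans t<w w≤n)))
        (trans (cong toℕ q) (trans (class-label v) (label-< v<w)))))

-- The finite checks

nth : {A : Set} → A → List A → ℕ → A
nth d []       _       = d
nth d (x ∷ xs) zero    = x
nth d (x ∷ xs) (suc i) = nth d xs i

-- The new vertex goes in front, so that the twin class still occupies a final segment of the
-- indices.
ext : (ℕ → Bool) → Adj → Adj
ext x R zero    zero    = false
ext x R zero    (suc j) = x j
ext x R (suc i) zero    = x i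
ext x R (suc i) (suc j) = R i j

binary : ℕ → ℕ → List Bool
binary zero    c = []
binary (suc m) c = (c % 2 ≡ᵇ 1) ∷ binary m (c / 2)

decode : List ℕ → Adj
decode []      = λ _ _ → false
decode (c ∷ g) = ext (nth false (binary (suc (length g)) c)) (decode g)

table : ℕ → Adj → Adj
table c e a b =
  if a <ᵇ b then e a b else if b <ᵇ a then e b a else if a ≡ᵇ c then e c (suc c) else false

-- Identifying all vertices from c on makes them twins; e c (suc c) decides their mutual adjacency.
blowUp : ℕ → Adj → Adj
blowUp c e i j = table c e (c ⊓ i) (c ⊓ j)

-- 1-17 are the graphs H, those with n-dependent rules numbered backwards (see Reversal);
-- 18 is the star, 19 is K_n - e and 20 is K_1 ∨ (K_1 + K_{n-2}).
rule : ℕ → Adj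
rule 1  i j = (2 <ᵇ j) ∨ ((j ≡ᵇ 2) ∧ (i ≡ᵇ 1))
rule 2  i j = 2 <ᵇ j
rule 3  i j = (3 <ᵇ j) ∨ (j ≡ᵇ suc i) ∨ ((j ≡ᵇ 3) ∧ (i ≡ᵇ 0))
rule 4  i j = (3 <ᵇ j) ∨ (j ≡ᵇ suc i)
rule 5  i j = (3 <ᵇ j) ∨ ((j ≡ᵇ 3) ∧ (i ≡ᵇ 2)) ∨ ((j ≡ᵇ 1) ∧ (i ≡ᵇ 0))
rule 6  i j = (i <ᵇ 2) ∧ (j ≥ᵇ 2)
rule 7  i j = i <ᵇ 2
rule 8  i j = (i <ᵇ 2) ∨ (i ≥ᵇ 3)
rule 9  i j = ((i <ᵇ 2) ∧ (j ≥ᵇ 2)) ∨ (i ≥ᵇ 3)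
rule 10 i j = (i ≡ᵇ 0) ∨ ((i ≡ᵇ 1) ∧ (j ≡ᵇ 2)) ∨ (i ≥ᵇ 3)
rule 11 i j = ((j <ᵇ 3) ∧ (j ≡ᵇ suc i))
            ∨ ((i <ᵇ 3) ∧ (j ≥ᵇ 3) ∧ not ((i ≡ᵇ 0) ∧ (j ≡ᵇ 3)))
            ∨ (i ≥ᵇ 4)
rule 12 i j = (i ≡ᵇ 0) ∨ ((i ≡ᵇ 1) ∧ (j ≡ᵇ 2))
rule 13 i j = (i ≡ᵇ 0) ∨ (i ≥ᵇ 3)
rule 14 i j = (i ≡ᵇ 0) ∨ ((i ≥ᵇ 2) ∧ not ((i ≡ᵇ 2) ∧ (j ≡ᵇ 3)))
rule 15 i j = ((i ≡ᵇ 0) ∧ (j ≡ᵇ 2)) ∨ ((i ≥ᵇ 1) ∧ (j ≥ᵇ 3))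
rule 16 i j = ((i ≡ᵇ 0) ∧ not (j ≡ᵇ 2)) ∨ ((i ≡ᵇ 1) ∧ (j ≡ᵇ 2)) ∨ (i ≥ᵇ 3)
rule 17 i j = ((i ≡ᵇ 0) ∧ not (j ≡ᵇ 2)) ∨ ((i ≡ᵇ 1) ∧ (j ≡ᵇ 2))
rule 18 i j = i ≡ᵇ 0
rule 19 i j = 1 <ᵇ j
rule 20 i j = (i ≡ᵇ 0) ∨ (i ≥ᵇ 2)
rule _  i j = false

-- The number of vertices ahead of the twin class, with a dummy entry for index 0.
core : ℕ → ℕ
core = nth 0 (0 ∷ 3 ∷ 3 ∷ 4 ∷ 4 ∷ 4 ∷ 2 ∷ 2 ∷ 3 ∷ 3 ∷ 3 ∷ 4 ∷ 3 ∷ 3 ∷ 4 ∷ 3 ∷ 3 ∷ 3 ∷ 2 ∷ 2 ∷ 2 ∷ [])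

family : ℕ → Adj
family k = blowUp (core k) (rule k)

families : ℕ → Adj
families k = family (suc k)

record Match (w : ℕ) (R S : Adj) (σ : ℕ → ℕ) : Set where
  constructor match
  field
    bounded : ∀ i → i < w → σ i < w
    matches : ∀ i → i < w → ∀ j → j < w → i ≡ j ⊎ (σ i ≢ σ j × R (σ i) (σ j) ≡ S i j)

match? : ∀ w R S σ → Dec (Match w R S σ)
match? w R S σ = map′ (λ (b , m) → match b m) (λ M → Match.bounded M , Match.matches M)
  (all<? (λ i → σ i <? w) w ×-dec
   all<? (λ i → all<? (λ j → (i ≟ j) ⊎-dec (¬? (σ i ≟ σ j) ×-dec (R (σ i) (σ j) ≟ᵇ S i j))) w) w)

-- The matchings of isomorphic graphs are found by an unverified backtracking search guided by degrees
-- and checked afterwards with match?.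
degrees : ℕ → Adj → List ℕ
degrees w R = applyUpTo (λ i → degree i w) w
  where
  degree : ℕ → ℕ → ℕ
  degree i zero    = 0
  degree i (suc j) = if i ≡ᵇ j then degree i j else if R i j then suc (degree i j) else degree i j

-- Decimal digit `d` counts the vertices of degree `d`; since at most eight vertices occur, equal
-- weights mean equal degree multisets.
weight : List ℕ → ℕ
weight []       = 0
weight (d ∷ ds) = 10 ^ d + weight ds

matchings : ℕ → Adj → List ℕ → Adj → List ℕ → List (List ℕ)
matchings w R ds S es = go w []
  where
  fits : ℕ → ℕ → ℕ → List ℕ → Bool
  fits i u j []       = true
  fits i u j (v ∷ vs) = if u ≡ᵇ v then false else
    if R u v then (if S i j then fits i u (suc j) vs else false)
    else if S i j then false else fits i u (suc j) vs
  go : ℕ → List ℕ → List (List ℕ)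
  go zero    vs = vs ∷ []
  go (suc i) vs = concatMap (λ u →
    if nth 0 ds u ≡ᵇ nth 0 es i then (if fits i u (suc i) vs then go i (u ∷ vs) else []) else []) (downFrom w)

candidates : ℕ → Adj → List ℕ → (ℕ → Adj) → ℕ → List (List ℕ) → List (ℕ × List ℕ)
candidates w R ds S k []         = []
candidates w R ds S k (es ∷ ess) =
  (if weight ds ≡ᵇ weight es then map (k ,_) (matchings w R ds (S k) es) else [])
  ++ candidates w R ds S (suc k) ess

Matched : ℕ → Adj → ℕ → (ℕ → Adj) → List (ℕ × List ℕ) → Set
Matched w R N S = Any λ (k , s) → k < N × Match w R (S k) (nth 0 s)

matched? : ∀ w R N S cs → Dec (Matched w R N S cs)
matched? w R N S = Any.any? λ (k , s) → (k <? N) ×-dec match? w R (S k) (nth 0 s)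

-- Checking all extensions by one vertex

allBool? : ∀ {P : Bool → Set} → Decidable P → Dec (∀ b → P b)
allBool? P? = map′ (λ { (f , t) false → f ; (f , t) true → t }) (λ h → h false , h true)
  (P? false ×-dec P? true)

data AllBits (Q : List Bool → Set) : ℕ → Set where
  leaf : Q [] → AllBits Q 0
  node : ∀ {m} → AllBits (λ x → Q (true ∷ x)) m → AllBits (λ x → Q (false ∷ x)) m → AllBits Q (suc m)

allBits? : ∀ {Q} → Decidable Q → ∀ m → Dec (AllBits Q m)
allBits? Q? zero    = map′ leaf (λ { (leaf q) → q }) (Q? [])
allBits? Q? (suc m) = map′ (λ (t , f) → node t f) (λ { (node t f) → t , f })
  (allBits? (λ x → Q? (true ∷ x)) m ×-dec allBits? (λ x → Q? (false ∷ x)) m)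

Certified : ℕ → List (List ℕ) → Adj → Set
Certified w ps R = Any (λ p → Certificate w 3 (nth 0 p) R) ps

certified? : ∀ w ps R → Dec (Certified w ps R)
certified? w ps R = Any.any? (λ p → certificate? w 3 (nth 0 p) R) ps

Resolved : ℕ → List (List ℕ) → ℕ → (ℕ → Adj) → List (List ℕ) → Adj → Set
Resolved w ps N S profiles U =
  Certified w ps U ⊎ Matched w U N S (candidates w U (degrees w U) S 0 profiles)

-- Only nonempty rows are considered, since growth always adds a vertex adjacent to the part already
-- embedded.
Extensions : ℕ → List (List ℕ) → ℕ → (ℕ → Adj) → List (List ℕ) → Adj → Set
Extensions m ps N S profiles R =
  AllBits (λ x → Any (_≡ true) x → Resolved (suc m) ps N S profiles (ext (nth false x) R)) m

extensions? : ∀ m ps N S profiles R → Dec (Extensions m ps N S profiles R)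
extensions? m ps N S profiles R = allBits? (λ x → Any.any? (_≟ᵇ true) x →-dec
  (let U = ext (nth false x) R in certified? (suc m) ps U ⊎-dec
    matched? (suc m) U N S (candidates (suc m) U (degrees (suc m) U) S 0 profiles))) m

graphs : List (List ℕ) → ℕ → Adj
graphs gs k = decode (nth [] gs k)

LevelOK : ℕ → List (List ℕ) → ℕ → (ℕ → Adj) → ℕ → (ℕ → Adj) → Set
LevelOK m ps M R N S = ∀ k → k < M → Extensions m ps N S (applyUpTo (degrees (suc m) ∘ S) N) (R k)

levelOK? : ∀ m ps M R N S → Dec (LevelOK m ps M R N S)
levelOK? m ps M R N S = all<? (λ k → extensions? m ps N S (applyUpTo (degrees (suc m) ∘ S) N) (R k)) M

-- Representatives of the connected non-complete graphs on 3, ..., 6 vertices without a certificate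
-- of defect 3, as binary adjacency rows: bit j of the first row is the pair {0 , suc j}, and so on.
level3 : List (List ℕ)
level3 =
  (2 ∷ 1 ∷ []) ∷ []

level4 : List (List ℕ)
level4 =
  (4 ∷ 2 ∷ 1 ∷ []) ∷ (2 ∷ 2 ∷ 1 ∷ []) ∷ (6 ∷ 2 ∷ 1 ∷ []) ∷ (3 ∷ 2 ∷ 1 ∷ []) ∷
  (7 ∷ 2 ∷ 1 ∷ []) ∷ []

level5 : List (List ℕ)
level5 =
  (8 ∷ 4 ∷ 2 ∷ 1 ∷ []) ∷ (4 ∷ 4 ∷ 2 ∷ 1 ∷ []) ∷ (12 ∷ 4 ∷ 2 ∷ 1 ∷ []) ∷ (6 ∷ 4 ∷ 2 ∷ 1 ∷ []) ∷
  (14 ∷ 4 ∷ 2 ∷ 1 ∷ []) ∷ (7 ∷ 4 ∷ 2 ∷ 1 ∷ []) ∷ (15 ∷ 4 ∷ 2 ∷ 1 ∷ []) ∷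
  (12 ∷ 2 ∷ 2 ∷ 1 ∷ []) ∷ (2 ∷ 2 ∷ 2 ∷ 1 ∷ []) ∷ (10 ∷ 2 ∷ 2 ∷ 1 ∷ []) ∷
  (14 ∷ 2 ∷ 2 ∷ 1 ∷ []) ∷ (3 ∷ 2 ∷ 2 ∷ 1 ∷ []) ∷ (11 ∷ 2 ∷ 2 ∷ 1 ∷ []) ∷
  (15 ∷ 2 ∷ 2 ∷ 1 ∷ []) ∷ (10 ∷ 6 ∷ 2 ∷ 1 ∷ []) ∷ (13 ∷ 6 ∷ 2 ∷ 1 ∷ []) ∷
  (7 ∷ 6 ∷ 2 ∷ 1 ∷ []) ∷ (15 ∷ 6 ∷ 2 ∷ 1 ∷ []) ∷ (15 ∷ 3 ∷ 2 ∷ 1 ∷ []) ∷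
  (15 ∷ 7 ∷ 2 ∷ 1 ∷ []) ∷ []

level6 : List (List ℕ)
level6 =
  (16 ∷ 8 ∷ 4 ∷ 2 ∷ 1 ∷ []) ∷ (8 ∷ 8 ∷ 4 ∷ 2 ∷ 1 ∷ []) ∷ (24 ∷ 8 ∷ 4 ∷ 2 ∷ 1 ∷ []) ∷
  (15 ∷ 8 ∷ 4 ∷ 2 ∷ 1 ∷ []) ∷ (31 ∷ 8 ∷ 4 ∷ 2 ∷ 1 ∷ []) ∷ (25 ∷ 12 ∷ 4 ∷ 2 ∷ 1 ∷ []) ∷
  (15 ∷ 12 ∷ 4 ∷ 2 ∷ 1 ∷ []) ∷ (31 ∷ 12 ∷ 4 ∷ 2 ∷ 1 ∷ []) ∷ (29 ∷ 14 ∷ 4 ∷ 2 ∷ 1 ∷ []) ∷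
  (27 ∷ 14 ∷ 4 ∷ 2 ∷ 1 ∷ []) ∷ (15 ∷ 14 ∷ 4 ∷ 2 ∷ 1 ∷ []) ∷ (31 ∷ 14 ∷ 4 ∷ 2 ∷ 1 ∷ []) ∷
  (14 ∷ 7 ∷ 4 ∷ 2 ∷ 1 ∷ []) ∷ (30 ∷ 7 ∷ 4 ∷ 2 ∷ 1 ∷ []) ∷ (31 ∷ 7 ∷ 4 ∷ 2 ∷ 1 ∷ []) ∷
  (31 ∷ 15 ∷ 4 ∷ 2 ∷ 1 ∷ []) ∷ (29 ∷ 12 ∷ 2 ∷ 2 ∷ 1 ∷ []) ∷ (21 ∷ 10 ∷ 2 ∷ 2 ∷ 1 ∷ []) ∷
  (29 ∷ 14 ∷ 2 ∷ 2 ∷ 1 ∷ []) ∷ (27 ∷ 14 ∷ 2 ∷ 2 ∷ 1 ∷ []) ∷ (31 ∷ 14 ∷ 2 ∷ 2 ∷ 1 ∷ []) ∷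
  (30 ∷ 15 ∷ 2 ∷ 2 ∷ 1 ∷ []) ∷ (31 ∷ 15 ∷ 2 ∷ 2 ∷ 1 ∷ []) ∷ (26 ∷ 10 ∷ 6 ∷ 2 ∷ 1 ∷ []) ∷
  (15 ∷ 10 ∷ 6 ∷ 2 ∷ 1 ∷ []) ∷ (31 ∷ 10 ∷ 6 ∷ 2 ∷ 1 ∷ []) ∷ (27 ∷ 13 ∷ 6 ∷ 2 ∷ 1 ∷ []) ∷
  (15 ∷ 13 ∷ 6 ∷ 2 ∷ 1 ∷ []) ∷ (31 ∷ 13 ∷ 6 ∷ 2 ∷ 1 ∷ []) ∷ (30 ∷ 7 ∷ 6 ∷ 2 ∷ 1 ∷ []) ∷
  (31 ∷ 7 ∷ 6 ∷ 2 ∷ 1 ∷ []) ∷ (31 ∷ 15 ∷ 6 ∷ 2 ∷ 1 ∷ []) ∷ (30 ∷ 15 ∷ 3 ∷ 2 ∷ 1 ∷ []) ∷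
  (31 ∷ 15 ∷ 3 ∷ 2 ∷ 1 ∷ []) ∷ (31 ∷ 15 ∷ 7 ∷ 2 ∷ 1 ∷ []) ∷ []

-- Partitions, as lists of class labels, that suffice as certificates in all the extensions below;
-- found by a greedy covering search.
parts6 : List (List ℕ)
parts6 =
  (0 ∷ 1 ∷ 0 ∷ 1 ∷ 2 ∷ 2 ∷ []) ∷ (0 ∷ 0 ∷ 0 ∷ 1 ∷ 2 ∷ 1 ∷ []) ∷ (0 ∷ 1 ∷ 2 ∷ 0 ∷ 1 ∷ 2 ∷ []) ∷
  (0 ∷ 0 ∷ 1 ∷ 2 ∷ 1 ∷ 2 ∷ []) ∷ (0 ∷ 1 ∷ 2 ∷ 1 ∷ 2 ∷ 1 ∷ []) ∷ (0 ∷ 1 ∷ 1 ∷ 1 ∷ 0 ∷ 2 ∷ []) ∷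
  (0 ∷ 1 ∷ 2 ∷ 1 ∷ 2 ∷ 0 ∷ []) ∷ (0 ∷ 1 ∷ 0 ∷ 1 ∷ 2 ∷ 1 ∷ []) ∷ (0 ∷ 0 ∷ 1 ∷ 2 ∷ 0 ∷ 1 ∷ []) ∷
  (0 ∷ 1 ∷ 0 ∷ 1 ∷ 1 ∷ 2 ∷ []) ∷ (0 ∷ 1 ∷ 2 ∷ 2 ∷ 0 ∷ 1 ∷ []) ∷ (0 ∷ 1 ∷ 2 ∷ 1 ∷ 0 ∷ 0 ∷ []) ∷
  (0 ∷ 1 ∷ 1 ∷ 1 ∷ 2 ∷ 0 ∷ []) ∷ (0 ∷ 0 ∷ 1 ∷ 0 ∷ 1 ∷ 2 ∷ []) ∷ (0 ∷ 1 ∷ 0 ∷ 1 ∷ 2 ∷ 0 ∷ []) ∷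
  (0 ∷ 1 ∷ 1 ∷ 0 ∷ 2 ∷ 2 ∷ []) ∷ (0 ∷ 0 ∷ 0 ∷ 1 ∷ 2 ∷ 2 ∷ []) ∷ (0 ∷ 1 ∷ 2 ∷ 2 ∷ 1 ∷ 0 ∷ []) ∷
  (0 ∷ 1 ∷ 1 ∷ 0 ∷ 2 ∷ 0 ∷ []) ∷ (0 ∷ 1 ∷ 2 ∷ 2 ∷ 1 ∷ 2 ∷ []) ∷ (0 ∷ 1 ∷ 2 ∷ 2 ∷ 0 ∷ 2 ∷ []) ∷
  (0 ∷ 1 ∷ 2 ∷ 1 ∷ 0 ∷ 1 ∷ []) ∷ []

parts7 : List (List ℕ)
parts7 =
  (0 ∷ 1 ∷ 0 ∷ 1 ∷ 2 ∷ 3 ∷ 3 ∷ []) ∷ (0 ∷ 0 ∷ 1 ∷ 1 ∷ 0 ∷ 2 ∷ 3 ∷ []) ∷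
  (0 ∷ 1 ∷ 2 ∷ 1 ∷ 3 ∷ 2 ∷ 2 ∷ []) ∷ (0 ∷ 1 ∷ 2 ∷ 3 ∷ 0 ∷ 1 ∷ 2 ∷ []) ∷
  (0 ∷ 1 ∷ 1 ∷ 2 ∷ 3 ∷ 2 ∷ 3 ∷ []) ∷ (0 ∷ 0 ∷ 1 ∷ 1 ∷ 2 ∷ 3 ∷ 2 ∷ []) ∷
  (0 ∷ 1 ∷ 0 ∷ 0 ∷ 2 ∷ 1 ∷ 3 ∷ []) ∷ (0 ∷ 1 ∷ 2 ∷ 2 ∷ 1 ∷ 3 ∷ 3 ∷ []) ∷
  (0 ∷ 1 ∷ 0 ∷ 2 ∷ 3 ∷ 3 ∷ 1 ∷ []) ∷ (0 ∷ 1 ∷ 1 ∷ 2 ∷ 1 ∷ 3 ∷ 2 ∷ []) ∷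
  (0 ∷ 1 ∷ 2 ∷ 3 ∷ 3 ∷ 1 ∷ 2 ∷ []) ∷ (0 ∷ 0 ∷ 1 ∷ 2 ∷ 1 ∷ 3 ∷ 1 ∷ []) ∷
  (0 ∷ 1 ∷ 1 ∷ 2 ∷ 3 ∷ 0 ∷ 2 ∷ []) ∷ (0 ∷ 1 ∷ 1 ∷ 1 ∷ 2 ∷ 3 ∷ 3 ∷ []) ∷
  (0 ∷ 1 ∷ 0 ∷ 2 ∷ 1 ∷ 3 ∷ 3 ∷ []) ∷ (0 ∷ 0 ∷ 1 ∷ 0 ∷ 0 ∷ 2 ∷ 3 ∷ []) ∷
  (0 ∷ 1 ∷ 2 ∷ 2 ∷ 0 ∷ 3 ∷ 1 ∷ []) ∷ (0 ∷ 1 ∷ 2 ∷ 3 ∷ 0 ∷ 0 ∷ 3 ∷ []) ∷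
  (0 ∷ 1 ∷ 2 ∷ 1 ∷ 1 ∷ 0 ∷ 3 ∷ []) ∷ (0 ∷ 1 ∷ 2 ∷ 3 ∷ 0 ∷ 3 ∷ 1 ∷ []) ∷
  (0 ∷ 1 ∷ 0 ∷ 0 ∷ 0 ∷ 2 ∷ 3 ∷ []) ∷ []

parts8 : List (List ℕ)
parts8 =
  (0 ∷ 1 ∷ 2 ∷ 3 ∷ 4 ∷ 2 ∷ 0 ∷ 3 ∷ []) ∷ (0 ∷ 1 ∷ 2 ∷ 3 ∷ 1 ∷ 4 ∷ 0 ∷ 2 ∷ []) ∷
  (0 ∷ 1 ∷ 2 ∷ 3 ∷ 4 ∷ 3 ∷ 2 ∷ 4 ∷ []) ∷ (0 ∷ 1 ∷ 2 ∷ 3 ∷ 2 ∷ 4 ∷ 3 ∷ 4 ∷ []) ∷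
  (0 ∷ 1 ∷ 2 ∷ 3 ∷ 3 ∷ 4 ∷ 0 ∷ 1 ∷ []) ∷ (0 ∷ 1 ∷ 2 ∷ 3 ∷ 2 ∷ 3 ∷ 1 ∷ 4 ∷ []) ∷
  (0 ∷ 1 ∷ 0 ∷ 2 ∷ 1 ∷ 2 ∷ 3 ∷ 4 ∷ []) ∷ (0 ∷ 1 ∷ 2 ∷ 3 ∷ 4 ∷ 0 ∷ 1 ∷ 2 ∷ []) ∷
  (0 ∷ 1 ∷ 2 ∷ 2 ∷ 3 ∷ 3 ∷ 1 ∷ 4 ∷ []) ∷ (0 ∷ 1 ∷ 2 ∷ 3 ∷ 1 ∷ 4 ∷ 0 ∷ 1 ∷ []) ∷
  (0 ∷ 1 ∷ 2 ∷ 2 ∷ 0 ∷ 1 ∷ 3 ∷ 4 ∷ []) ∷ (0 ∷ 1 ∷ 0 ∷ 2 ∷ 3 ∷ 4 ∷ 1 ∷ 3 ∷ []) ∷ []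

parts9 : List (List ℕ)
parts9 =
  (0 ∷ 1 ∷ 2 ∷ 3 ∷ 4 ∷ 2 ∷ 5 ∷ 2 ∷ 5 ∷ []) ∷ (0 ∷ 1 ∷ 0 ∷ 2 ∷ 3 ∷ 4 ∷ 5 ∷ 5 ∷ 4 ∷ []) ∷ []

-- Each partition merges two pairs among seven vertices, leaving five classes and hence defect 2.
pairs7 : List (List ℕ)
pairs7 =
  (0 ∷ 1 ∷ 2 ∷ 3 ∷ 2 ∷ 1 ∷ 4 ∷ []) ∷ (0 ∷ 1 ∷ 2 ∷ 0 ∷ 1 ∷ 3 ∷ 4 ∷ []) ∷ []

-- An extended family is described by its new vertex, its four core vertices and one exceptional
-- vertex, all later vertices being twins; so a permutation of the first six vertices is compared.
fixFrom6 : List ℕ → ℕ → ℕ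
fixFrom6 s i with i <? 6
... | yes _ = nth 0 s i
... | no  _ = i

record TailMatch (R S : Adj) (s : List ℕ) : Set where
  constructor tailMatch
  field
    permutes : ∀ i → i < 6 → nth 0 s i < 6
    agrees   : Match 8 R S (fixFrom6 s)

tailMatch? : ∀ R S s → Dec (TailMatch R S s)
tailMatch? R S s = map′ (λ (p , a) → tailMatch p a) (λ M → TailMatch.permutes M , TailMatch.agrees M)
  (all<? (λ i → nth 0 s i <? 6) 6 ×-dec match? 8 R S (fixFrom6 s))

TailMatched : Adj → List (ℕ × List ℕ) → Set
TailMatched U = Any λ (k , s) → k < 20 × TailMatch U (family (suc k)) s

-- Of the eight vertices the last two represent the tail: they enter the degrees, but the search
-- permutes only the first six.
FamilyResolved : List (List ℕ) → Adj → Set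
FamilyResolved profiles U =
  Certified 8 parts8 U ⊎ TailMatched U (candidates 6 U (degrees 8 U) families 0 profiles)

-- `b` is the common adjacency of the new vertex to all twins from index 5 on. It takes part in the
-- nonemptiness condition because the new vertex may be adjacent to those twins only.
FamilyExtensions : List (List ℕ) → Adj → Bool → Set
FamilyExtensions profiles R b =
  AllBits (λ x → Any (_≡ true) (b ∷ x) → FamilyResolved profiles (ext (nth b x) R)) 5

familyExtensions? : ∀ profiles R b → Dec (FamilyExtensions profiles R b)
familyExtensions? profiles R b = allBits? (λ x → Any.any? (_≟ᵇ true) (b ∷ x) →-dec
  (let U = ext (nth b x) R in certified? 8 parts8 U ⊎-dec
    Any.any? (λ (k , s) → (k <? 20) ×-dec tailMatch? U (family (suc k)) s)
      (candidates 6 U (degrees 8 U) families 0 profiles))) 5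

-- Indices 4 to 7 are four twins, of which the new vertex misses two and sees two; whatever its
-- adjacency to the core, a certificate exists.
MixedExtensions : Adj → Set
MixedExtensions R = AllBits
  (λ x → Certified 9 parts9 (ext (nth false (x ++ false ∷ false ∷ true ∷ true ∷ [])) R)) 4

mixedExtensions? : ∀ R → Dec (MixedExtensions R)
mixedExtensions? R = allBits?
  (λ x → certified? 9 parts9 (ext (nth false (x ++ false ∷ false ∷ true ∷ true ∷ [])) R)) 4

record FamilyStep (profiles : List (List ℕ)) : Set where
  constructor familyStep
  field
    extensions : ∀ k → k < 20 → ∀ b → FamilyExtensions profiles (family (suc k)) b
    mixed      : ∀ k → k < 20 → MixedExtensions (family (suc k))

familyStep? : ∀ profiles → Dec (FamilyStep profiles)
familyStep? profiles = map′
  (λ (e , m) → familyStep e m) (λ F → FamilyStep.extensions F , FamilyStep.mixed F)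
  (all<? (λ k → allBool? (familyExtensions? profiles (family (suc k)))) 20 ×-dec
   all<? (λ k → mixedExtensions? (family (suc k))) 20)

-- Growing embeddings vertex by vertex

-- Indices from `c` on are interchangeable, so `R` is determined by its values on indices up to `c`,
-- and a finite check covers all orders.
Clamped : ℕ → Adj → Set
Clamped c R = ∀ i j → R i j ≡ R (i ⊓ c) (j ⊓ c)

clamped-weaken : ∀ {c c′ R} → c ≤ c′ → Clamped c R → Clamped c′ R
clamped-weaken {c} {c′} {R} c≤c′ cl i j = trans (cl i j)
  (sym (trans (cl (i ⊓ c′) (j ⊓ c′)) (cong₂ R (absorb i) (absorb j))))
  where
  absorb : ∀ i → i ⊓ c′ ⊓ c ≡ i ⊓ c
  absorb i = trans (⊓-assoc i c′ c) (cong (i ⊓_) (m≥n⇒m⊓n≡n c≤c′))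

clamped-cong : ∀ {c R} → Clamped c R → ∀ {i i′ j j′} → i ⊓ c ≡ i′ ⊓ c → j ⊓ c ≡ j′ ⊓ c → R i j ≡ R i′ j′
clamped-cong {R = R} cl {i} {i′} {j} {j′} p q = trans (cl i j) (trans (cong₂ R p q) (sym (cl i′ j′)))

blowUp-clamped : ∀ c e → Clamped c (blowUp c e)
blowUp-clamped c e i j = cong₂ (table c e) (sym (absorb i)) (sym (absorb j))
  where
  absorb : ∀ i → c ⊓ (i ⊓ c) ≡ c ⊓ i
  absorb i = trans (sym (⊓-assoc c i c)) (trans (⊓-comm (c ⊓ i) c)
    (trans (sym (⊓-assoc c c i)) (cong (_⊓ i) (⊓-idem c))))

core≤4 : ∀ k → k < 20 → core (suc k) ≤ 4
core≤4 = toWitness {a? = all<? (λ k → core (suc k) ≤? 4) 20} _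

family-clamped : ∀ k → k < 20 → Clamped 4 (family (suc k))
family-clamped k k<20 = clamped-weaken (core≤4 k k<20) (blowUp-clamped (core (suc k)) (rule (suc k)))

nth-clamped : ∀ {A : Set} (d : A) xs j → nth d xs j ≡ nth d xs (j ⊓ length xs)
nth-clamped d []       j       = refl
nth-clamped d (x ∷ xs) zero    = refl
nth-clamped d (x ∷ xs) (suc j) = nth-clamped d xs j

nth-applyUpTo : ∀ {A : Set} (d : A) f {m j} → j < m → nth d (applyUpTo f m) j ≡ f j
nth-applyUpTo d f {suc m} {zero}  _   = refl
nth-applyUpTo d f {suc m} {suc j} j<m = nth-applyUpTo d (f ∘ suc) (s<s⁻¹ j<m)

nth-applyUpTo-≥ : ∀ {A : Set} (d : A) f {m j} → m ≤ j → nth d (applyUpTo f m) j ≡ d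
nth-applyUpTo-≥ d f {zero}          _   = refl
nth-applyUpTo-≥ d f {suc m} {suc j} m≤j = nth-applyUpTo-≥ d (f ∘ suc) (s≤s⁻¹ m≤j)

ext-clamped : ∀ {c R} d xs → length xs ≡ c → Clamped c R → Clamped (suc c) (ext (nth d xs) R)
ext-clamped d xs refl cl zero    zero    = refl
ext-clamped d xs refl cl zero    (suc j) = nth-clamped d xs j
ext-clamped d xs refl cl (suc i) zero    = nth-clamped d xs i
ext-clamped d xs refl cl (suc i) (suc j) = cl i j

allBits-lookup : ∀ {m Q} → AllBits Q m → ∀ x → Q (applyUpTo x m)
allBits-lookup (leaf q)   x = q
allBits-lookup (node t f) x with x 0
... | true  = allBits-lookup t (x ∘ suc)
... | false = allBits-lookup f (x ∘ suc)

-- Keeps the core indices and lets `τ` choose which tail vertices follow.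
prefixed : ℕ → (ℕ → ℕ) → ℕ → ℕ
prefixed c τ i with i <? c
... | yes _ = i
... | no  _ = τ (i ∸ c)

prefixed-⊓ : ∀ c τ → (∀ i → c ≤ τ i) → ∀ i → prefixed c τ i ⊓ c ≡ i ⊓ c
prefixed-⊓ c τ c≤τ i with i <? c
... | yes _  = refl
... | no i≮c = trans (m≥n⇒m⊓n≡n (c≤τ (i ∸ c))) (sym (m≥n⇒m⊓n≡n (≮⇒≥ i≮c)))

prefixed-injBelow : ∀ c {m} τ → (∀ i → c ≤ τ i) → InjBelow m τ → InjBelow (c + m) (prefixed c τ)
prefixed-injBelow c {m} τ c≤τ τ-inj {i} {j} i< j< e with i <? c | j <? c
... | yes _   | yes _   = e
... | yes i<c | no  _   = contradiction (subst (_< c) e i<c) (≤⇒≯ (c≤τ _))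
... | no  _   | yes j<c = contradiction (subst (_< c) (sym e) j<c) (≤⇒≯ (c≤τ _))
... | no  i≮c | no  j≮c = ∸-cancelʳ-≡ (≮⇒≥ i≮c) (≮⇒≥ j≮c) (τ-inj (lower i≮c i<) (lower j≮c j<) e)
  where
  lower : ∀ {i} → ¬ i < c → i < c + m → i ∸ c < m
  lower {i} i≮c i< = subst (i ∸ c <_) (m+n∸m≡n c m) (∸-monoˡ-< i< (≮⇒≥ i≮c))

swap : ℕ → ℕ → ℕ → ℕ
swap s t i with i ≟ s | i ≟ t
... | yes _ | _     = t
... | no  _ | yes _ = s
... | no  _ | no  _ = i

swap-involutive : ∀ s t i → swap s t (swap s t i) ≡ i
swap-involutive s t i with i ≟ s | i ≟ t
... | yes refl | _ with t ≟ s | t ≟ t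
... | yes t≡s | _ = t≡s
... | no  _   | yes _ = refl
... | no  _   | no t≢t = contradiction refl t≢t
swap-involutive s t i | no _ | yes refl with s ≟ s
... | yes _ = refl
... | no s≢s = contradiction refl s≢s
swap-involutive s t i | no i≢s | no i≢t with i ≟ s | i ≟ t
... | yes i≡s | _ = contradiction i≡s i≢s
... | no _ | yes i≡t = contradiction i≡t i≢t
... | no _ | no _ = refl

swap-⊓ : ∀ {c s t} → c ≤ s → c ≤ t → ∀ i → swap s t i ⊓ c ≡ i ⊓ c
swap-⊓ {c} {s} {t} c≤s c≤t i with i ≟ s | i ≟ t
... | yes refl | _        = trans (m≥n⇒m⊓n≡n c≤t) (sym (m≥n⇒m⊓n≡n c≤s))
... | no _     | yes refl = trans (m≥n⇒m⊓n≡n c≤s) (sym (m≥n⇒m⊓n≡n c≤t))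
... | no _     | no _     = refl

swap-< : ∀ {m s t} → s < m → t < m → ∀ i → i < m → swap s t i < m
swap-< {s = s} {t} s<m t<m i i<m with i ≟ s | i ≟ t
... | yes _ | _     = t<m
... | no _  | yes _ = s<m
... | no _  | no _  = i<m

-- Constancy is tested with value `x 4` and exception 4, with value `x 4` and exception `j₁`, and
-- with the opposite value and exception 4. If all three fail, both values occur twice: `4` and `j₃`
-- carry one, `j₁` and `j₂` the other.
classify : ∀ (x : ℕ → Bool) m → 4 < m →
  (∃[ t ] ∃[ b ] (4 ≤ t × t < m × (∀ j → 4 ≤ j → j < m → j ≢ t → x j ≡ b))) ⊎
  (∃[ a ] ∃[ a′ ] ∃[ b ] ∃[ b′ ] (a ≢ a′ × b ≢ b′ ×
    (4 ≤ a × a < m × x a ≡ false) × (4 ≤ a′ × a′ < m × x a′ ≡ false) ×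
    (4 ≤ b × b < m × x b ≡ true) × (4 ≤ b′ × b′ < m × x b′ ≡ true)))
classify x m 4<m = decide (scan 4 (x 4))
  where
  Outside : ℕ → Bool → Set
  Outside t b = ∃[ j ] (j < m × 4 ≤ j × j ≢ t × x j ≢ b)
  Constant : ℕ → Bool → Set
  Constant t b = ∀ j → 4 ≤ j → j < m → j ≢ t → x j ≡ b
  scan : ∀ t b → Outside t b ⊎ Constant t b
  scan t b with anyUpTo? (λ j → (4 ≤? j) ×-dec ¬? (j ≟ t) ×-dec ¬? (x j ≟ᵇ b)) m
  ... | yes h = inj₁ h
  ... | no ¬h = inj₂ agree
    where
    agree : Constant t b
    agree j 4≤j j<m j≢t with x j ≟ᵇ b
    ... | yes e = e
    ... | no ne = contradiction (j , j<m , 4≤j , j≢t , ne) ¬h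
  decide : Outside 4 (x 4) ⊎ Constant 4 (x 4) → _
  decide (inj₂ h) = inj₁ (4 , _ , ≤-refl , 4<m , h)
  decide (inj₁ (j₁ , j₁<m , 4≤j₁ , j₁≢4 , x₁≢)) with scan j₁ (x 4)
  ... | inj₂ h = inj₁ (j₁ , _ , 4≤j₁ , j₁<m , h)
  ... | inj₁ (j₂ , j₂<m , 4≤j₂ , j₂≢j₁ , x₂≢) with scan 4 (not (x 4))
  ... | inj₂ h = inj₁ (4 , _ , ≤-refl , 4<m , h)
  ... | inj₁ (j₃ , j₃<m , 4≤j₃ , j₃≢4 , x₃≢) with x 4 in x₄
  ... | false = inj₂ (4 , j₃ , j₁ , j₂ , j₃≢4 ∘ sym , j₂≢j₁ ∘ sym ,
    (≤-refl , 4<m , x₄) , (4≤j₃ , j₃<m , ¬-not x₃≢) , (4≤j₁ , j₁<m , ¬-not x₁≢) , (4≤j₂ , j₂<m , ¬-not x₂≢))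
  ... | true = inj₂ (j₁ , j₂ , 4 , j₃ , j₂≢j₁ ∘ sym , j₃≢4 ∘ sym ,
    (4≤j₁ , j₁<m , ¬-not x₁≢) , (4≤j₂ , j₂<m , ¬-not x₂≢) , (≤-refl , 4<m , x₄) , (4≤j₃ , j₃<m , ¬-not x₃≢))

-- Transporting and extending embeddings

module _ {n} {G : Graph n} where

  open Emb

  reindex : ∀ {w w′ R S} (σ : ℕ → ℕ) → Emb G w R → (∀ i → i < w′ → σ i < w) → InjBelow w′ σ →
    (∀ {i j} → i < w′ → j < w′ → i ≢ j → R (σ i) (σ j) ≡ S i j) → Emb G w′ S
  reindex σ emb σ< σ-inj R≡S = record
    { at     = at emb ∘ σ
    ; at-inj = λ i< j< → σ-inj i< j< ∘ at-inj emb (σ< _ i<) (σ< _ j<)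
    ; at-adj = λ i< j< i≢j →
        trans (at-adj emb (σ< _ i<) (σ< _ j<) (i≢j ∘ σ-inj i< j<)) (R≡S i< j< i≢j)
    }

  emb-≗ : ∀ {w R S} → (∀ {i j} → i < w → j < w → i ≢ j → R i j ≡ S i j) → Emb G w R → Emb G w S
  emb-≗ R≡S emb = reindex id emb (λ _ → id) (λ _ _ → id) R≡S

  match-emb : ∀ {w R S σ} → Match w R S σ → Emb G w R → Emb G w S
  match-emb {w} {R} {S} {σ} M emb = reindex σ emb (Match.bounded M) σ-inj R≡S
    where
    σ-inj : InjBelow w σ
    σ-inj {i} {j} i< j< e with Match.matches M i i< j j<
    ... | inj₁ i≡j     = i≡j
    ... | inj₂ (ne , _) = contradiction e ne
    R≡S : ∀ {i j} → i < w → j < w → i ≢ j → R (σ i) (σ j) ≡ S i j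
    R≡S {i} {j} i< j< i≢j with Match.matches M i i< j j<
    ... | inj₁ i≡j     = contradiction i≡j i≢j
    ... | inj₂ (_ , e) = e

  -- Both relations treat all indices from 6 on alike and the permutation fixes these, so agreement
  -- on eight vertices implies agreement on any `m`.
  tailMatch-emb : ∀ {m R S s} → 8 ≤ m → Clamped 6 R → Clamped 6 S → TailMatch R S s → Emb G m R → Emb G m S
  tailMatch-emb {m} {R} {S} {s} 8≤m clR clS T emb = reindex σ emb σ< σ-inj R≡S
    where
    open TailMatch T
    open Match agrees
    σ : ℕ → ℕ
    σ = fixFrom6 s
    σ-< : ∀ {i} → i < 6 → σ i < 6
    σ-< {i} i<6 with i <? 6
    ... | yes _  = permutes i i<6
    ... | no i≮6 = contradiction i<6 i≮6
    σ-≥ : ∀ {i} → 6 ≤ i → σ i ≡ i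
    σ-≥ {i} 6≤i with i <? 6
    ... | yes i<6 = contradiction 6≤i (<⇒≱ i<6)
    ... | no _    = refl
    σ< : ∀ i → i < m → σ i < m
    σ< i i<m with <-≤-connex i 6
    ... | inj₁ i<6 = <-≤-trans (σ-< i<6) (≤-trans (m≤n+m 6 2) 8≤m)
    ... | inj₂ 6≤i = subst (_< m) (sym (σ-≥ 6≤i)) i<m
    σ-inj : InjBelow m σ
    σ-inj {i} {j} _ _ e with <-≤-connex i 6 | <-≤-connex j 6
    ... | inj₂ 6≤i | inj₂ 6≤j = trans (sym (σ-≥ 6≤i)) (trans e (σ-≥ 6≤j))
    ... | inj₁ i<6 | inj₂ 6≤j = contradiction (subst (_< 6) (trans e (σ-≥ 6≤j)) (σ-< i<6)) (≤⇒≯ 6≤j)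
    ... | inj₂ 6≤i | inj₁ j<6 = contradiction (subst (_< 6) (trans (sym e) (σ-≥ 6≤i)) (σ-< j<6)) (≤⇒≯ 6≤i)
    ... | inj₁ i<6 | inj₁ j<6 with matches i (<-≤-trans i<6 (m≤n+m 6 2)) j (<-≤-trans j<6 (m≤n+m 6 2))
    ... | inj₁ i≡j      = i≡j
    ... | inj₂ (ne , _) = contradiction e ne
    σ-⊓ : ∀ i → σ i ⊓ 6 ≡ σ (i ⊓ 6) ⊓ 6
    σ-⊓ i with <-≤-connex i 6
    ... | inj₁ i<6 = cong (λ k → σ k ⊓ 6) (sym (m≤n⇒m⊓n≡m (<⇒≤ i<6)))
    ... | inj₂ 6≤i rewrite σ-≥ 6≤i | m≥n⇒m⊓n≡n 6≤i = refl
    ⊓6<8 : ∀ i → i ⊓ 6 < 8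
    ⊓6<8 i = s≤s (≤-trans (m⊓n≤n i 6) (n≤1+n 6))
    R≡S : ∀ {i j} → i < m → j < m → i ≢ j → R (σ i) (σ j) ≡ S i j
    R≡S {i} {j} _ _ i≢j with matches (i ⊓ 6) (⊓6<8 i) (j ⊓ 6) (⊓6<8 j)
    ... | inj₂ (_ , e) = trans (clamped-cong clR (σ-⊓ i) (σ-⊓ j)) (trans e (sym (clS i j)))
    ... | inj₁ e with <-≤-connex i 6 | <-≤-connex j 6
    ... | inj₁ i<6 | inj₁ j<6 =
      contradiction (trans (sym (m≤n⇒m⊓n≡m (<⇒≤ i<6))) (trans e (m≤n⇒m⊓n≡m (<⇒≤ j<6)))) i≢j
    ... | inj₁ i<6 | inj₂ 6≤j =
      contradiction (trans (sym (m≤n⇒m⊓n≡m (<⇒≤ i<6))) (trans e (m≥n⇒m⊓n≡n 6≤j))) (<⇒≢ i<6)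
    ... | inj₂ 6≤i | inj₁ j<6 =
      contradiction (trans (sym (m≤n⇒m⊓n≡m (<⇒≤ j<6))) (trans (sym e) (m≥n⇒m⊓n≡n 6≤i))) (<⇒≢ j<6)
    -- Two distinct tail indices both clamp to 6; the checked pair 6, 7 stands for them.
    ... | inj₂ 6≤i | inj₂ 6≤j with matches 6 (m≤n+m 7 1) 7 ≤-refl
    ... | inj₂ (_ , e′) = trans (cong₂ R (σ-≥ 6≤i) (σ-≥ 6≤j))
      (trans (clamped-cong clR {i} {6} {j} {7} (m≥n⇒m⊓n≡n 6≤i) (m≥n⇒m⊓n≡n 6≤j))
        (trans e′ (clamped-cong clS {6} {i} {7} {j} (sym (m≥n⇒m⊓n≡n 6≤i)) (sym (m≥n⇒m⊓n≡n 6≤j)))))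

  ext-emb : ∀ {m R v} x (emb : Emb G m R) → (∀ {i} → i < m → at emb i ≢ v) →
    (∀ {j} → j < m → E G v (at emb j) ≡ x j) → Emb G (suc m) (ext x R)
  ext-emb {m} {R} {v} x emb at≢v v~ = record
    { at = v ◂ at emb ; at-inj = ◂-injBelow (at emb) (at-inj emb) at≢v ; at-adj = adj′ }
    where
    adj′ : ∀ {i j} → i < suc m → j < suc m → i ≢ j → E G ((v ◂ at emb) i) ((v ◂ at emb) j) ≡ ext x R i j
    adj′ {zero}  {zero}  _  _  i≢j = contradiction refl i≢j
    adj′ {zero}  {suc j} _  j< i≢j = v~ (s<s⁻¹ j<)
    adj′ {suc i} {zero}  i< _  i≢j = trans (E-sym G _ v) (v~ (s<s⁻¹ i<))
    adj′ {suc i} {suc j} i< j< i≢j = at-adj emb (s<s⁻¹ i<) (s<s⁻¹ j<) (i≢j ∘ cong suc)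

  -- A walk from `f 0` to a vertex that is missed must at some step leave the vertices listed by
  -- `f`.
  frontier : Connected G → ∀ {m} (f : ℕ → Fin n) → 0 < m → m < n →
    ∃[ v ] ((∀ {i} → i < m → f i ≢ v) × ∃[ j ] (j < m × E G v (f j) ≡ true))
  frontier conn {m} f 0<m m<n with fresh {m = m} f m<n
  ... | u , f≢u = leave 0<m (proj₂ (conn (f 0) u))
    where
    leave : ∀ {i d} → i < m → Walk G (f i) u d →
      ∃[ v ] ((∀ {i} → i < m → f i ≢ v) × ∃[ j ] (j < m × E G v (f j) ≡ true))
    leave i<m here = contradiction refl (f≢u i<m)
    leave {i} i<m (step {w = x} e p) with hit? m f x
    ... | yes (j , j<m , refl) = leave j<m p
    ... | no ¬h = x , (λ j<m q → ¬h (_ , j<m , q)) , i , i<m , trans (E-sym G x (f i)) e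

-- Growth of cliques, small graphs and families

complete : Adj
complete _ _ = true

module _ {n} (G : Graph n) (conn : Connected G) (2≤n : 2 ≤ n) where

  open Emb

  -- A clique is enlarged until it spans the graph or a frontier vertex misses one of its members.
  -- In the latter case the frontier vertex, a member it sees and one it misses induce a path.
  complete-or-path : ∀ d {m} → d + m ≡ n → 0 < m → Emb G m complete →
    Emb G n complete ⊎ Emb G 3 (graphs level3 0)
  complete-or-path zero    refl _ emb = inj₁ emb
  complete-or-path (suc d) {m} e 0<m emb
    with frontier conn {m} (at emb) 0<m (subst (m <_) e (s≤s (m≤n+m m d)))
  ... | v , at≢v , j₁ , j₁<m , v~j₁ with anyUpTo? (λ j → E G v (at emb j) ≟ᵇ false) m
  ... | no all = complete-or-path d (trans (+-suc d m) e) (s≤s z≤n)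
    (emb-≗ extended (ext-emb (λ _ → true) emb at≢v λ {j} j<m → ¬-not λ q → all (j , j<m , q)))
    where
    extended : ∀ {i j} → i < suc m → j < suc m → i ≢ j → ext (λ _ → true) complete i j ≡ true
    extended {zero}  {zero}  _ _ i≢j = contradiction refl i≢j
    extended {zero}  {suc j} _ _ _   = refl
    extended {suc i} {zero}  _ _ _   = refl
    extended {suc i} {suc j} _ _ _   = refl
  ... | yes (j₀ , j₀<m , v≁j₀) = inj₂ (emb-≗ path (ext-emb {m = 2} bits pair fresh′ adj′))
    where
    σ : ℕ → ℕ
    σ = j₀ ◂ (λ _ → j₁)
    σ< : ∀ i → i < 2 → σ i < m
    σ< zero          _ = j₀<m
    σ< (suc zero)    _ = j₁<m
    σ< (suc (suc _)) (s≤s (s≤s ()))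
    j₁≢j₀ : j₁ ≢ j₀
    j₁≢j₀ refl = contradiction (trans (sym v~j₁) v≁j₀) λ ()
    pair : Emb G 2 complete
    pair = reindex σ emb σ< (◂-injBelow {m = 1} (λ _ → j₁) (λ { (s≤s z≤n) (s≤s z≤n) _ → refl }) (λ _ → j₁≢j₀))
      λ _ _ _ → refl
    bits : ℕ → Bool
    bits = nth false (false ∷ true ∷ [])
    fresh′ : ∀ {i} → i < 2 → at pair i ≢ v
    fresh′ {i} i<2 = at≢v (σ< i i<2)
    adj′ : ∀ {j} → j < 2 → E G v (at pair j) ≡ bits j
    adj′ {zero}        _ = v≁j₀
    adj′ {suc zero}    _ = v~j₁
    adj′ {suc (suc _)} (s≤s (s≤s ()))
    path : ∀ {i j} → i < 3 → j < 3 → i ≢ j → ext bits complete i j ≡ graphs level3 0 i j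
    path {0} {0} _ _ ne = contradiction refl ne
    path {0} {1} _ _ _  = refl
    path {0} {2} _ _ _  = refl
    path {1} {0} _ _ _  = refl
    path {1} {1} _ _ ne = contradiction refl ne
    path {1} {2} _ _ _  = refl
    path {2} {0} _ _ _  = refl
    path {2} {1} _ _ _  = refl
    path {2} {2} _ _ ne = contradiction refl ne
    path {suc (suc (suc _))} (s≤s (s≤s (s≤s ())))
    path {0} {suc (suc (suc _))} _ (s≤s (s≤s (s≤s ())))
    path {1} {suc (suc (suc _))} _ (s≤s (s≤s (s≤s ())))
    path {2} {suc (suc (suc _))} _ (s≤s (s≤s (s≤s ())))

  module _ (¬n-3 : ¬ ResDomPartition G (n ∸ 3)) where

    uncertified : ∀ {w ps R} → 3 ≤ w → Emb G w R → ¬ Certified w ps R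
    uncertified 3≤w emb certs =
      ¬n-3 (certificate⇒resDom G conn 2≤n emb 3≤w (proj₂ (Any.satisfied certs)))

    -- The row of a frontier vertex is among those checked; as certificates are excluded, the
    -- enlarged graph matches a representative.
    level-step : ∀ {m ps M R N S} → LevelOK m ps M R N S → 2 ≤ m → m < n →
      ∃[ k ] (k < M × Emb G m (R k)) → ∃[ k ] (k < N × Emb G (suc m) (S k))
    level-step {m} {ps} {R = R} {N} {S} ok 2≤m m<n (k , k<M , emb)
      with frontier conn {m} (at emb) (≤-trans (s≤s z≤n) 2≤m) m<n
    ... | v , at≢v , j , j<m , v~j = result
      (allBits-lookup (ok k k<M) x (applyUpTo⁺ x v~j j<m))
      where
      x : ℕ → Bool
      x i = E G v (at emb i)
      U : Adj
      U = ext (nth false (applyUpTo x m)) (R k)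
      emb′ : Emb G (suc m) U
      emb′ = ext-emb _ emb at≢v λ i<m → sym (nth-applyUpTo false x i<m)
      result : Resolved (suc m) ps N S (applyUpTo (degrees (suc m) ∘ S) N) U → ∃[ k ] (k < N × Emb G (suc m) (S k))
      result (inj₁ certs) = contradiction certs (uncertified (s≤s 2≤m) emb′)
      result (inj₂ matched) with Any.satisfied matched
      ... | (k′ , s) , k′<N , M = k′ , k′<N , match-emb M emb′

    -- If the new vertex treats all tail vertices but at most one alike, the extension is among
    -- those checked for the family. Otherwise it splits the tail two against two, and the core with
    -- four tail vertices and the new one has a certificate.
    family-step : ∀ {profiles} → FamilyStep profiles → ∀ {m} → 7 ≤ m → m < n →
      ∃[ k ] (k < 20 × Emb G m (family (suc k))) → ∃[ k ] (k < 20 × Emb G (suc m) (family (suc k)))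
    family-step {profiles} ok {m} 7≤m m<n (k , k<20 , emb)
      with frontier conn {m} (at emb) (≤-trans (s≤s z≤n) 7≤m) m<n
    ... | v , at≢v , j₀ , j₀<m , v~j₀ with classify (λ i → E G v (at emb i)) m (≤-trans (m≤n+m 5 2) 7≤m)
    ... | inj₁ (t , b , 4≤t , t<m , const) = result (allBits-lookup (FamilyStep.extensions ok k k<20 b) x some-true)
      where
      F : Adj
      F = family (suc k)
      clF : Clamped 4 F
      clF = family-clamped k k<20
      4<m : 4 < m
      4<m = ≤-trans (m≤n+m 5 2) 7≤m
      -- The exceptional tail vertex is moved to index 4, the first beyond every core; the row is
      -- then constant from 5 on.
      σ : ℕ → ℕ
      σ = swap 4 t
      emb₁ : Emb G m F
      emb₁ = reindex σ emb (swap-< 4<m t<m)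
        (λ {i} {j} _ _ e → trans (sym (swap-involutive 4 t i)) (trans (cong σ e) (swap-involutive 4 t j)))
        λ {i} {j} _ _ _ → clamped-cong clF (swap-⊓ ≤-refl 4≤t i) (swap-⊓ ≤-refl 4≤t j)
      x : ℕ → Bool
      x i = E G v (at emb₁ i)
      x-tail : ∀ {i} → 5 ≤ i → i < m → x i ≡ b
      x-tail {i} 5≤i i<m = const (σ i) 4≤σi (swap-< 4<m t<m i i<m) σi≢t
        where
        4≤σi : 4 ≤ σ i
        4≤σi = m⊓n≡n⇒n≤m (trans (swap-⊓ ≤-refl 4≤t i) (m≥n⇒m⊓n≡n (<⇒≤ 5≤i)))
        σi≢t : σ i ≢ t
        σi≢t e = <⇒≢ 5≤i (sym (trans (sym (swap-involutive 4 t i)) (trans (cong σ e) swap-t)))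
          where
          swap-t : σ t ≡ 4
          swap-t = swap-involutive 4 t 4
      U : Adj
      U = ext (nth b (applyUpTo x 5)) F
      emb₂ : Emb G (suc m) U
      emb₂ = ext-emb _ emb₁ (λ {i} i<m → at≢v (swap-< 4<m t<m i i<m)) bits
        where
        bits : ∀ {i} → i < m → x i ≡ nth b (applyUpTo x 5) i
        bits {i} i<m with <-≤-connex i 5
        ... | inj₁ i<5 = sym (nth-applyUpTo b x i<5)
        ... | inj₂ 5≤i = trans (x-tail 5≤i i<m) (sym (nth-applyUpTo-≥ b x 5≤i))
      some-true : Any (_≡ true) (b ∷ applyUpTo x 5)
      some-true with <-≤-connex (σ j₀) 5
      ... | inj₁ σj<5 = Any.there (applyUpTo⁺ x (trans (cong (λ i → E G v (at emb i)) (swap-involutive 4 t j₀)) v~j₀) σj<5)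
      ... | inj₂ 5≤σj = Any.here (trans (sym (x-tail 5≤σj (swap-< 4<m t<m j₀ j₀<m)))
        (trans (cong (λ i → E G v (at emb i)) (swap-involutive 4 t j₀)) v~j₀))
      result : FamilyResolved profiles U → ∃[ k ] (k < 20 × Emb G (suc m) (family (suc k)))
      result (inj₁ certs) = contradiction certs (uncertified {w = 8} (s≤s (s≤s (s≤s z≤n)))
        (reindex id emb₂ (λ i i<8 → <-≤-trans i<8 (s≤s 7≤m)) (λ _ _ → id) λ _ _ _ → refl))
      result (inj₂ matched) with Any.satisfied matched
      ... | (k′ , s) , k′<20 , T = k′ , k′<20 , tailMatch-emb (s≤s 7≤m)
        -- The clamp is 6: four core vertices, the exceptional twin and the vertex put in front.
        (ext-clamped b (applyUpTo x 5) refl (clamped-weaken (n≤1+n 4) clF))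
        (clamped-weaken (m≤n+m 4 2) (family-clamped k′ k′<20)) T emb₂
    family-step {profiles} ok {m} 7≤m m<n (k , k<20 , emb) | v , at≢v , _
      | inj₂ (a , a′ , b , b′ , a≢a′ , b≢b′ , (4≤a , a<m , xa) , (4≤a′ , a′<m , xa′) , (4≤b , b<m , xb) , (4≤b′ , b′<m , xb′)) =
      contradiction (allBits-lookup (FamilyStep.mixed ok k k<20) x) (uncertified {w = 9} (s≤s (s≤s (s≤s z≤n)))
        (ext-emb _ emb₁ (λ {i} i<8 → at≢v (σ< i i<8)) λ {j} → bits j))
      where
      x : ℕ → Bool
      x i = E G v (at emb i)
      apart : ∀ {i j} → x i ≡ false → x j ≡ true → j ≢ i
      apart p q refl = contradiction (trans (sym p) q) λ ()
      -- First the two missed twins, then the two seen ones, in the order fixed by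
      -- `MixedExtensions`.
      τ : ℕ → ℕ
      τ = a ◂ a′ ◂ b ◂ (λ _ → b′)
      4≤τ : ∀ i → 4 ≤ τ i
      4≤τ 0 = 4≤a
      4≤τ 1 = 4≤a′
      4≤τ 2 = 4≤b
      4≤τ (suc (suc (suc _))) = 4≤b′
      τ< : ∀ i → τ i < m
      τ< 0 = a<m
      τ< 1 = a′<m
      τ< 2 = b<m
      τ< (suc (suc (suc _))) = b′<m
      τ-inj : InjBelow 4 τ
      τ-inj = ◂-injBelow _ (◂-injBelow _ (◂-injBelow {m = 1} _ (λ { (s≤s z≤n) (s≤s z≤n) _ → refl })
          λ _ → b≢b′ ∘ sym)
          λ { {0} _ → apart xa′ xb ; {suc _} _ → apart xa′ xb′ })
          λ { {0} _ → a≢a′ ∘ sym ; {1} _ → apart xa xb ; {suc (suc _)} _ → apart xa xb′ }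
      σ : ℕ → ℕ
      σ = prefixed 4 τ
      σ< : ∀ i → i < 8 → σ i < m
      σ< i _ with i <? 4
      ... | yes i<4 = <-≤-trans i<4 (≤-trans (m≤n+m 4 3) 7≤m)
      ... | no _    = τ< (i ∸ 4)
      emb₁ : Emb G 8 (family (suc k))
      emb₁ = reindex σ emb σ< (prefixed-injBelow 4 τ 4≤τ τ-inj)
        λ {i} {j} _ _ _ → clamped-cong (family-clamped k k<20) (prefixed-⊓ 4 τ 4≤τ i) (prefixed-⊓ 4 τ 4≤τ j)
      bits : ∀ j → j < 8 → x (σ j) ≡ nth false (applyUpTo x 4 ++ false ∷ false ∷ true ∷ true ∷ []) j
      bits 0 _ = refl
      bits 1 _ = refl
      bits 2 _ = refl
      bits 3 _ = refl
      bits 4 _ = xa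
      bits 5 _ = xa′
      bits 6 _ = xb
      bits 7 _ = xb′
      bits (suc (suc (suc (suc (suc (suc (suc (suc j)))))))) j<8 = contradiction j<8 (≤⇒≯ (m≤m+n 8 j))

-- In the checks below only the truth value of a decision is evaluated; the proof is recovered from
-- it.
witness : ∀ {A : Set} (A? : Dec A) → does A? ≡ true → A
witness (yes a) _ = a

familyProfiles : List (List ℕ)
familyProfiles = applyUpTo (degrees 8 ∘ families) 20

abstract
  level3-check : does (levelOK? 3 [] 1 (graphs level3) 5 (graphs level4)) ≡ true
  level3-check = refl

  -- Up to five vertices the list of partitions is empty: every extension matches a representative.
  level3-ok : LevelOK 3 [] 1 (graphs level3) 5 (graphs level4)
  level3-ok = witness (levelOK? 3 [] 1 (graphs level3) 5 (graphs level4)) level3-check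

  level4-check : does (levelOK? 4 [] 5 (graphs level4) 20 (graphs level5)) ≡ true
  level4-check = refl

  level4-ok : LevelOK 4 [] 5 (graphs level4) 20 (graphs level5)
  level4-ok = witness (levelOK? 4 [] 5 (graphs level4) 20 (graphs level5)) level4-check

  level5-check : does (levelOK? 5 parts6 20 (graphs level5) 35 (graphs level6)) ≡ true
  level5-check = refl

  level5-ok : LevelOK 5 parts6 20 (graphs level5) 35 (graphs level6)
  level5-ok = witness (levelOK? 5 parts6 20 (graphs level5) 35 (graphs level6)) level5-check

  level6-check : does (levelOK? 6 parts7 35 (graphs level6) 20 families) ≡ true
  level6-check = refl

  level6-ok : LevelOK 6 parts7 35 (graphs level6) 20 families
  level6-ok = witness (levelOK? 6 parts7 35 (graphs level6) 20 families) level6-check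

  families-check : does (familyStep? familyProfiles) ≡ true
  families-check = refl

  families-ok : FamilyStep familyProfiles
  families-ok = witness (familyStep? familyProfiles) families-check

-- Lower bounds from twins

-- Two shapes for which n - c classes are too few: a core vertex joined to a clique of twins, or
-- twins with no neighbour but one core vertex.
record Rigid (c : ℕ) (R : Adj) : Set where
  constructor rigid
  field
    apex   : ℕ
    apex<c : apex < c
    kind   : (R apex c ≡ true × R c c ≡ true) ⊎ (∀ t → t < suc c → R c t ≡ true → t ≡ apex)

rigid? : ∀ c R → Dec (Rigid c R)
rigid? c R = map′ (λ (a , a<c , k) → rigid a a<c k) (λ r → let open Rigid r in apex , apex<c , kind)
  (any<? (λ a → ((R a c ≟ᵇ true) ×-dec (R c c ≟ᵇ true)) ⊎-dec
    all<? (λ t → (R c t ≟ᵇ true) →-dec (t ≟ a)) (suc c)) c)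

-- It is used for `z` not joined to the twins: through `u`, both `a` and every twin are then at
-- distance two from `z`.
Bridged : ℕ → Adj → ℕ → ℕ → Set
Bridged c R z a = R a c ≡ true × R a z ≡ false ×
  ∃[ u ] (u < c × R u c ≡ true × u ≢ a × R a u ≡ true × R u z ≡ true)

-- `joined` keeps a class free of twins away from the core vertices joined to the twins, and `loose`
-- keeps it away from the at most one remaining core vertex.
record Anchored (c : ℕ) (R : Adj) : Set where
  constructor anchored
  field
    clique : R c c ≡ true
    joined : ∀ z → z < c → R z c ≡ true → ∃[ y ] (y < c × y ≢ z × R z y ≡ true × R y c ≡ true)
    loose  : ∀ z → z < c → R z c ≡ false →
      (∃[ a ] (a < c × Bridged c R z a)) × (∀ t → t < c → R t c ≡ false → t ≡ z)

anchored? : ∀ c R → Dec (Anchored c R)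
anchored? c R = map′ (λ (q , j , l) → anchored q j l) (λ A → let open Anchored A in clique , joined , loose)
  ((R c c ≟ᵇ true) ×-dec
   all<? (λ z → (R z c ≟ᵇ true) →-dec
     any<? (λ y → ¬? (y ≟ z) ×-dec (R z y ≟ᵇ true) ×-dec (R y c ≟ᵇ true)) c) c ×-dec
   all<? (λ z → (R z c ≟ᵇ false) →-dec
     (any<? (λ a → (R a c ≟ᵇ true) ×-dec (R a z ≟ᵇ false) ×-dec
       any<? (λ u → (R u c ≟ᵇ true) ×-dec ¬? (u ≟ a) ×-dec (R a u ≟ᵇ true) ×-dec (R u z ≟ᵇ true)) c) c
     ×-dec all<? (λ t → (R t c ≟ᵇ false) →-dec (t ≟ z)) c)) c)

module _ {n} {G : Graph n} {R c} (cl : Clamped c R) (emb : Emb G n R) (c<n : c < n)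
         {k} (P : Partition n k) (res : Resolving G P) where

  open Emb emb

  private
    class : ℕ → Fin k
    class i = cls P (at i)

    index : ∀ v → ∃[ i ] (i < n × at i ≡ v)
    index = injBelow⇒surjective at at-inj ≤-refl

    at-≢ : ∀ {i j} → i < n → j < n → i ≢ j → at i ≢ at j
    at-≢ i< j< i≢j = i≢j ∘ at-inj i< j<

    R-tailʳ : ∀ i {j} → c ≤ j → R i j ≡ R i c
    R-tailʳ i c≤j = clamped-cong cl {i} {i} refl (trans (m≥n⇒m⊓n≡n c≤j) (sym (⊓-idem c)))

    R-tailˡ : ∀ {i} j → c ≤ i → R i j ≡ R c j
    R-tailˡ j c≤i = clamped-cong cl {j = j} {j} (trans (m≥n⇒m⊓n≡n c≤i) (sym (⊓-idem c))) refl

    tail-separated : ∀ {i j} → c ≤ i → i < n → c ≤ j → j < n → i ≢ j → class i ≢ class j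
    tail-separated {i} {j} c≤i i<n c≤j j<n i≢j = twins-separated G P res (at-≢ i<n j<n i≢j) twin
      where
      twin : ∀ x → x ≢ at i → x ≢ at j → E G (at i) x ≡ E G (at j) x
      twin x x≢i x≢j with index x
      ... | t , t<n , refl = trans (at-adj i<n t<n λ { refl → x≢i refl })
        (trans (trans (R-tailˡ t c≤i) (sym (R-tailˡ t c≤j))) (sym (at-adj j<n t<n λ { refl → x≢j refl })))

    tailClass : ℕ → Fin k
    tailClass i = class (c + i)

    c+<n : ∀ {i} → i < n ∸ c → c + i < n
    c+<n {i} i< = subst (c + i <_) (m+[n∸m]≡n (<⇒≤ c<n)) (+-monoʳ-< c i<)

    tailClass-inj : InjBelow (n ∸ c) tailClass
    tailClass-inj {i} {j} i< j< e with i ≟ j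
    ... | yes i≡j = i≡j
    ... | no  i≢j = contradiction e
      (tail-separated (m≤m+n c i) (c+<n i<) (m≤m+n c j) (c+<n j<) (i≢j ∘ +-cancelˡ-≡ c i j))

    Tail : Fin k → Set
    Tail j = ∃[ i ] (c ≤ i × i < n × class i ≡ j)

    tail? : ∀ j → Dec (Tail j)
    tail? j = map′ (λ (i , i<n , c≤i , e) → i , c≤i , i<n , e) (λ (i , c≤i , i<n , e) → i , i<n , c≤i , e)
      (anyUpTo? (λ i → (c ≤? i) ×-dec (class i ≟ᶠ j)) n)

    tail-adj : ∀ {i t} → i < n → c ≤ t → t < n → i ≢ t → R i c ≡ true → AdjTo G P (at i) (class t)
    tail-adj i<n c≤t t<n i≢t Ric = at _ , trans (at-adj i<n t<n i≢t) (trans (R-tailʳ _ c≤t) Ric) , refl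

    -- A twin lying in class `j` is a neighbour of both vertices, so `j` is at distance one from
    -- each.
    unresolved-by-tail : ∀ {a b j} → a < n → b < n → R a c ≡ true → R b c ≡ true →
      j ≢ class a → class a ≡ class b → Tail j → AdjTo G P (at a) j × AdjTo G P (at b) j
    unresolved-by-tail a<n b<n Ra Rb j≢ a≈b (t , c≤t , t<n , refl) =
      tail-adj a<n c≤t t<n (λ { refl → j≢ refl }) Ra ,
      tail-adj b<n c≤t t<n (λ { refl → j≢ (sym a≈b) }) Rb

    tail-Rc : R c c ≡ true → ∀ {b} → c ≤ b → R b c ≡ true
    tail-Rc Rcc {b} c≤b = trans (R-tailˡ c c≤b) Rcc

    -- The core vertex shares its class with some twin, and each other class contains a twin
    -- adjacent to both.
    clique-tail : ∀ {a} → a < c → R a c ≡ true → R c c ≡ true → ¬ (∀ j → Tail j)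
    clique-tail {a} a<c Rac Rcc tails with tails (class a)
    ... | b , c≤b , b<n , b≈a with resolvent G P res (at-≢ (<-trans a<c c<n) b<n λ { refl → <⇒≱ a<c c≤b }) (sym b≈a)
    ... | j , j≢ , ¬both , _ =
      ¬both (unresolved-by-tail (<-trans a<c c<n) b<n Rac (tail-Rc Rcc c≤b) j≢ (sym b≈a) (tails j))

    -- The twin in the class of `a` has no neighbour other than `a`, so it is not dominated.
    leaf-tail : Dominating G P → ∀ {a} → a < c → (∀ t → t < suc c → R c t ≡ true → t ≡ a) → ¬ (∀ j → Tail j)
    leaf-tail dom {a} a<c sole tails with tails (class a)
    ... | b , c≤b , b<n , b≈a with dom (at b)
    ... | j , D with distTo-1⁻ G P D
    ... | x , e , x∈j with index x
    ... | t , t<n , refl = contradiction (distTo-unique G P D (distTo-own G P (at b) b∈j)) λ ()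
      where
      Rbt : R b t ≡ true
      Rbt = trans (sym (at-adj b<n t<n λ { refl → contradiction (trans (sym e) (E-irrefl G _)) λ () })) e
      t⊓c≡a : t ⊓ c ≡ a
      t⊓c≡a = sole (t ⊓ c) (s≤s (m⊓n≤n t c)) (trans (clamped-cong cl
        (trans (⊓-idem c) (sym (m≥n⇒m⊓n≡n c≤b))) (trans (⊓-assoc t c c) (cong (t ⊓_) (⊓-idem c)))) Rbt)
      t≡a : t ≡ a
      t≡a with <-≤-connex t c
      ... | inj₁ t<c = trans (sym (m≤n⇒m⊓n≡m (<⇒≤ t<c))) t⊓c≡a
      ... | inj₂ c≤t = contradiction (trans (sym (m≥n⇒m⊓n≡n c≤t)) t⊓c≡a) (<⇒≢ a<c ∘ sym)
      b∈j : class b ≡ j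
      b∈j = trans b≈a (trans (cong class (sym t≡a)) x∈j)

  tail≤classes : n ∸ c ≤ k
  tail≤classes = injBelow⇒≤ tailClass tailClass-inj

  -- With at most n - c classes the twins, lying in distinct classes, would occupy all of them.
  rigid-bound : Rigid c R → Dominating G P → n ∸ c < k
  rigid-bound r dom = ≰⇒> λ k≤ →
    let tails = λ j → let i , i< , e = injBelow⇒surjective tailClass tailClass-inj k≤ j
                      in c + i , m≤m+n c i , c+<n i< , e
    in [ (λ (Rac , Rcc) → clique-tail apex<c Rac Rcc tails)
       , (λ sole → leaf-tail dom apex<c sole tails) ]′ kind
    where open Rigid r

  -- With n - c + 1 classes exactly one class J misses the tail, so every resolution of a core
  -- vertex from the tail vertex in its class is due to J.
  module _ (A : Anchored c R) (k≤ : k ≤ suc (n ∸ c)) (J : Fin k) (¬J : ¬ Tail J) where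

    open Anchored A
    private
      <n : ∀ {i} → i < c → i < n
      <n i<c = <-trans i<c c<n
      other : ∀ j → j ≢ J → Tail j
      other j j≢J with injBelow⇒surjective (J ◂ tailClass) (◂-injBelow tailClass tailClass-inj
        λ {i} i< e → ¬J (c + i , m≤m+n c i , c+<n i< , e)) k≤ j
      ... | zero  , _  , e = contradiction (sym e) j≢J
      ... | suc i , i< , e = c + i , m≤m+n c i , c+<n (s<s⁻¹ i<) , e
      J-core : ∀ {i} → i < n → class i ≡ J → i < c
      J-core {i} i<n e with <-≤-connex i c
      ... | inj₁ i<c = i<c
      ... | inj₂ c≤i = contradiction (i , c≤i , i<n , e) ¬J
      tail-edge : ∀ {a b r} → a < c → R a c ≡ r → c ≤ b → b < n → E G (at a) (at b) ≡ r
      tail-edge {a} a<c Rac c≤b b<n =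
        trans (at-adj (<n a<c) b<n (<⇒≢ (<-≤-trans a<c c≤b))) (trans (R-tailʳ a c≤b) Rac)
      Mate : ℕ → Set
      Mate a = ∃[ b ] (c ≤ b × b < n × class b ≢ J × ¬ (AdjTo G P (at a) J × AdjTo G P (at b) J) ×
        (∀ {d} → DistTo G P (at a) J d → ¬ DistTo G P (at b) J d))
      mate : ∀ {a} → a < c → R a c ≡ true → class a ≢ J → Mate a
      mate {a} a<c Rac a∉J with other (class a) a∉J
      ... | b , c≤b , b<n , b≈a with resolvent G P res (at-≢ (<n a<c) b<n λ { refl → <⇒≱ a<c c≤b }) (sym b≈a)
      ... | j , j≢ , ¬both , ¬same with j ≟ᶠ J
      ... | yes refl = b , c≤b , b<n , (λ e → a∉J (trans (sym b≈a) e)) , ¬both , ¬same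
      ... | no j≢J = contradiction
        (unresolved-by-tail (<n a<c) b<n Rac (tail-Rc clique c≤b) j≢ (sym b≈a) (other j j≢J)) ¬both
      -- Every class other than `J` contains a twin adjacent to both vertices, so nothing would
      -- resolve them inside `J`.
      not-both : ∀ {a b} → a < c → b < c → a ≢ b → R a c ≡ true → R b c ≡ true → class a ≡ J → class b ≢ J
      not-both a<c b<c a≢b Rac Rbc a∈J b∈J
        with resolvent G P res (at-≢ (<n a<c) (<n b<c) a≢b) (trans a∈J (sym b∈J))
      ... | j , j≢ , ¬both , _ = ¬both (unresolved-by-tail (<n a<c) (<n b<c) Rac Rbc j≢ (trans a∈J (sym b∈J))
        (other j λ { refl → j≢ (sym a∈J) }))
      -- The neighbour `y` of `z` and the twin sharing the class of `y` would both be adjacent to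
      -- `z` in `J`, so `J` could not resolve them.
      not-full : ∀ {z} → z < c → R z c ≡ true → class z ≢ J
      not-full {z} z<c Rzc z∈J =
        let y , y<c , y≢z , Rzy , Ryc = joined z z<c Rzc
            b , c≤b , b<n , _ , ¬both , _ = mate y<c Ryc (not-both z<c y<c (y≢z ∘ sym) Rzc Ryc z∈J)
        in ¬both
          ( (at z , trans (E-sym G (at y) (at z)) (trans (at-adj (<n z<c) (<n y<c) (y≢z ∘ sym)) Rzy) , z∈J)
          , (at z , trans (E-sym G (at b) (at z)) (tail-edge z<c Rzc c≤b b<n) , z∈J))

      -- `J` would consist of `z` alone, and `a` and the twin sharing its class would both be at
      -- distance two from it through `u`.
      loose-out : ∀ {z} → z < c → R z c ≡ false → class z ≢ J
      loose-out {z} z<c Rzc z∈J =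
        let (a , a<c , Rac , Raz , u , u<c , Ruc , u≢a , Rau , Ruz) , only = loose z z<c Rzc
            b , c≤b , b<n , b∉J , _ , ¬same = mate a<c Rac (not-full a<c Rac)
            u~J = at z , trans (at-adj (<n u<c) (<n z<c) (unequal Ruc)) Ruz , z∈J
        in ¬same
          (distTo-2 G P (not-full a<c Rac) (apart only (trans (at-adj (<n a<c) (<n z<c) (unequal Rac)) Raz))
            (trans (at-adj (<n a<c) (<n u<c) (u≢a ∘ sym)) Rau) u~J)
          (distTo-2 G P b∉J (apart only (trans (E-sym G (at b) (at z)) (tail-edge z<c Rzc c≤b b<n)))
            (trans (E-sym G (at b) (at u)) (tail-edge u<c Ruc c≤b b<n)) u~J)
        where
        unequal : ∀ {i} → R i c ≡ true → i ≢ z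
        unequal Ric refl = contradiction (trans (sym Ric) Rzc) λ ()
        member : (∀ t → t < c → R t c ≡ false → t ≡ z) → ∀ x → cls P x ≡ J → x ≡ at z
        member only x x∈J =
          let t , t<n , e = index x
              t∈J = trans (cong (cls P) e) x∈J
              t<c = J-core t<n t∈J
          in trans (sym e) (cong at (only t t<c (¬-not λ Rtc → not-full t<c Rtc t∈J)))
        apart : (∀ t → t < c → R t c ≡ false → t ≡ z) → ∀ {v} → E G v (at z) ≡ false → ¬ AdjTo G P v J
        apart only {v} v≁z (x , e , x∈J) =
          contradiction (trans (sym e) (trans (cong (E G v) (member only x x∈J)) v≁z)) λ ()

      core-out : ∀ {z} → z < c → class z ≢ J
      core-out {z} z<c with R z c ≟ᵇ true
      ... | yes Rzc = not-full z<c Rzc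
      ... | no ¬Rzc = loose-out z<c (¬-not ¬Rzc)

    missing-absurd : ⊥
    missing-absurd =
      let v , v∈J = surj P J
          z , z<n , e = index v
          z∈J = trans (cong (cls P) e) v∈J
      in core-out (J-core z<n z∈J) z∈J

  -- A class free of twins is refuted by `missing-absurd`; if there is none, `clique-tail` applies
  -- to a core vertex joined to the twins.
  anchored-bound : 0 < c → Anchored c R → suc (n ∸ c) < k
  anchored-bound 0<c A = ≰⇒> λ k≤ → refute k≤ (any? λ j → ¬? (tail? j))
    where
    open Anchored A
    full-exists : ∃[ a ] (a < c × R a c ≡ true)
    full-exists with R 0 c in R₀
    ... | true  = 0 , 0<c , R₀
    ... | false with loose 0 0<c R₀
    ... | (a , a<c , Rac , _) , _ = a , a<c , Rac
    refute : k ≤ suc (n ∸ c) → ¬ Dec (∃[ j ] ¬ Tail j)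
    refute k≤ (yes (J , ¬J)) = missing-absurd A k≤ J ¬J
    refute k≤ (no ¬∃) with full-exists
    ... | a , a<c , Rac = clique-tail a<c Rac clique λ j → tails j (tail? j)
      where
      tails : ∀ j → Dec (Tail j) → Tail j
      tails j (yes t) = t
      tails j (no ¬t) = contradiction (j , ¬t) ¬∃

-- Isomorphism with the graphs H

-- The adjacency built by `mkE`, on numbers instead of `Fin n`, for comparison with the families.
symmetrise : Adj → Adj
symmetrise e i j = if i <ᵇ j then e i j else if j <ᵇ i then e j i else false

<ᵇ-true : ∀ {i j} → i < j → (i <ᵇ j) ≡ true
<ᵇ-true {i} {j} i<j with i <? j in eq
... | yes _  = cong does eq
... | no i≮j = contradiction i<j i≮j

<ᵇ-false : ∀ {i j} → j ≤ i → (i <ᵇ j) ≡ false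
<ᵇ-false {i} {j} j≤i with i <? j in eq
... | yes i<j = contradiction j≤i (<⇒≱ i<j)
... | no _    = cong does eq

symmetrise-< : ∀ e {i j} → i < j → symmetrise e i j ≡ e i j
symmetrise-< e i<j rewrite <ᵇ-true i<j = refl

symmetrise-> : ∀ e {i j} → j < i → symmetrise e i j ≡ e j i
symmetrise-> e j<i rewrite <ᵇ-false (<⇒≤ j<i) | <ᵇ-true j<i = refl

table-sym : ∀ c e a b → table c e a b ≡ table c e b a
table-sym c e a b with <-cmp a b
... | tri< a<b _ _  rewrite <ᵇ-true a<b | <ᵇ-false (<⇒≤ a<b) = refl
... | tri≈ _ refl _ = refl
... | tri> _ _ b<a  rewrite <ᵇ-true b<a | <ᵇ-false (<⇒≤ b<a) = refl

family-sym : ∀ k i j → family k i j ≡ family k j i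
family-sym k i j = table-sym (core k) (rule k) (core k ⊓ i) (core k ⊓ j)

Upper : Adj → Adj → Set
Upper e F = ∀ {i j} → i < j → e i j ≡ F i j

-- Every core has at most four vertices, so once the indices are split at 4 the rules and the
-- families agree by computation.
upper : ∀ {e F} → (∀ i → i < 4 → ∀ j → j < 4 → i < j → e i j ≡ F i j) →
  (∀ j → e 0 (4 + j) ≡ F 0 (4 + j)) → (∀ j → e 1 (4 + j) ≡ F 1 (4 + j)) →
  (∀ j → e 2 (4 + j) ≡ F 2 (4 + j)) → (∀ j → e 3 (4 + j) ≡ F 3 (4 + j)) →
  (∀ i j → e (4 + i) (4 + j) ≡ F (4 + i) (4 + j)) → Upper e F
upper {e} {F} core-agree e₀ e₁ e₂ e₃ e₄ {i} {j} i<j with <-≤-connex j 4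
... | inj₁ j<4 = core-agree i (<-trans i<j j<4) j j<4 i<j
... | inj₂ 4≤j = subst (λ j → e i j ≡ F i j) (m+[n∸m]≡n 4≤j) (tail i (j ∸ 4))
  where
  tail : ∀ i j → e i (4 + j) ≡ F i (4 + j)
  tail 0 = e₀
  tail 1 = e₁
  tail 2 = e₂
  tail 3 = e₃
  tail (suc (suc (suc (suc i)))) = e₄ i

core-agrees : ∀ k → k < 18 → ∀ i → i < 4 → ∀ j → j < 4 → i < j → rule k i j ≡ family k i j
core-agrees = toWitness {a? = all<? (λ k → all<? (λ i → all<? (λ j →
  (i <? j) →-dec (rule k i j ≟ᵇ family k i j)) 4) 4) 18} _

rule-upper : ∀ k → k < 18 → Upper (rule k) (family k)
rule-upper 0  k< = upper (core-agrees 0  k<) (λ _ → refl) (λ _ → refl) (λ _ → refl) (λ _ → refl) (λ _ _ → refl)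
rule-upper 1  k< = upper (core-agrees 1  k<) (λ _ → refl) (λ _ → refl) (λ _ → refl) (λ _ → refl) (λ _ _ → refl)
rule-upper 2  k< = upper (core-agrees 2  k<) (λ _ → refl) (λ _ → refl) (λ _ → refl) (λ _ → refl) (λ _ _ → refl)
rule-upper 3  k< = upper (core-agrees 3  k<) (λ _ → refl) (λ _ → refl) (λ _ → refl) (λ _ → refl) (λ _ _ → refl)
rule-upper 4  k< = upper (core-agrees 4  k<) (λ _ → refl) (λ _ → refl) (λ _ → refl) (λ _ → refl) (λ _ _ → refl)
rule-upper 5  k< = upper (core-agrees 5  k<) (λ _ → refl) (λ _ → refl) (λ _ → refl) (λ _ → refl) (λ _ _ → refl)
rule-upper 6  k< = upper (core-agrees 6  k<) (λ _ → refl) (λ _ → refl) (λ _ → refl) (λ _ → refl) (λ _ _ → refl)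
rule-upper 7  k< = upper (core-agrees 7  k<) (λ _ → refl) (λ _ → refl) (λ _ → refl) (λ _ → refl) (λ _ _ → refl)
rule-upper 8  k< = upper (core-agrees 8  k<) (λ _ → refl) (λ _ → refl) (λ _ → refl) (λ _ → refl) (λ _ _ → refl)
rule-upper 9  k< = upper (core-agrees 9  k<) (λ _ → refl) (λ _ → refl) (λ _ → refl) (λ _ → refl) (λ _ _ → refl)
rule-upper 10 k< = upper (core-agrees 10 k<) (λ _ → refl) (λ _ → refl) (λ _ → refl) (λ _ → refl) (λ _ _ → refl)
rule-upper 11 k< = upper (core-agrees 11 k<) (λ _ → refl) (λ _ → refl) (λ _ → refl) (λ _ → refl) (λ _ _ → refl)
rule-upper 12 k< = upper (core-agrees 12 k<) (λ _ → refl) (λ _ → refl) (λ _ → refl) (λ _ → refl) (λ _ _ → refl)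
rule-upper 13 k< = upper (core-agrees 13 k<) (λ _ → refl) (λ _ → refl) (λ _ → refl) (λ _ → refl) (λ _ _ → refl)
rule-upper 14 k< = upper (core-agrees 14 k<) (λ _ → refl) (λ _ → refl) (λ _ → refl) (λ _ → refl) (λ _ _ → refl)
rule-upper 15 k< = upper (core-agrees 15 k<) (λ _ → refl) (λ _ → refl) (λ _ → refl) (λ _ → refl) (λ _ _ → refl)
rule-upper 16 k< = upper (core-agrees 16 k<) (λ _ → refl) (λ _ → refl) (λ _ → refl) (λ _ → refl) (λ _ _ → refl)
rule-upper 17 k< = upper (core-agrees 17 k<) (λ _ → refl) (λ _ → refl) (λ _ → refl) (λ _ → refl) (λ _ _ → refl)
rule-upper (suc (suc (suc (suc (suc (suc (suc (suc (suc (suc (suc (suc (suc (suc (suc (suc (suc (suc k)))))))))))))))))) k< =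
  contradiction k< (≤⇒≯ (m≤m+n 18 k))

symmetrise-family : ∀ {e} k → Upper e (family k) → ∀ {i j} → i ≢ j → symmetrise e i j ≡ family k i j
symmetrise-family {e} k up {i} {j} i≢j with <-cmp i j
... | tri< i<j _ _ = trans (symmetrise-< e i<j) (up i<j)
... | tri≈ _ i≡j _ = contradiction i≡j i≢j
... | tri> _ _ j<i = trans (symmetrise-> e j<i) (trans (up j<i) (family-sym k j i))

-- Vertex numberings of the graphs `H`

record Layout {n} (K : Graph n) (F : Adj) : Set where
  field
    σ            : ℕ → ℕ
    σ<           : ∀ {i} → i < n → σ i < n
    σ-involutive : ∀ {i} → i < n → σ (σ i) ≡ i
    agrees       : ∀ u v → u ≢ v → E K u v ≡ F (σ (toℕ u)) (σ (toℕ v))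

directly : ∀ {n} k → k < 18 → Layout (mkGraph n (rule k)) (family k)
directly k k<18 = record
  { σ = id ; σ< = id ; σ-involutive = λ _ → refl
  ; agrees = λ u v u≢v → symmetrise-family {rule k} k (rule-upper k k<18) (u≢v ∘ toℕ-injective) }

module Reversal (n : ℕ) where

  -- Reversal turns thresholds such as `n ∸ 3` into constants and moves an initial clique of twins
  -- to the end.
  ρ : ℕ → ℕ
  ρ i = n ∸ suc i

  ρ< : ∀ {i} → i < n → ρ i < n
  ρ< {i} i<n = ∸-monoʳ-< {n} {suc i} {0} (s≤s z≤n) i<n

  ρ-involutive : ∀ {i} → i < n → ρ (ρ i) ≡ i
  ρ-involutive {i} i<n = trans (cong (n ∸_) (sym (+-∸-assoc 1 i<n))) (m∸[m∸n]≡n (<⇒≤ i<n))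

  ρ-mono : ∀ {i j} → j < n → i < j → ρ j < ρ i
  ρ-mono j<n i<j = ∸-monoʳ-< (s≤s i<j) j<n

  ρ-<ᵇ : ∀ {i k} → i < n → k < n → (i <ᵇ ρ k) ≡ (k <ᵇ ρ i)
  ρ-<ᵇ {i} {k} i<n k<n = does-⇔ (mk⇔ (flip i<n k<n) (flip k<n i<n)) (i <? ρ k) (k <? ρ i)
    where
    flip : ∀ {i k} → i < n → k < n → i < ρ k → k < ρ i
    flip i<n k<n i<ρk = subst (_< ρ _) (ρ-involutive k<n) (ρ-mono (ρ< k<n) i<ρk)

  ρ-≡ᵇ : ∀ {i k} → i < n → k < n → (i ≡ᵇ ρ k) ≡ (ρ i ≡ᵇ k)
  ρ-≡ᵇ {i} {k} i<n k<n = does-⇔ (mk⇔ (λ { refl → ρ-involutive k<n }) (λ { refl → sym (ρ-involutive i<n) })) (i ≟ ρ k) (ρ i ≟ k)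

  ρ-suc : ∀ {i j} → i < n → j < n → (j ≡ᵇ suc i) ≡ (ρ i ≡ᵇ suc (ρ j))
  ρ-suc {i} {j} i<n j<n = does-⇔ (mk⇔ to from) (j ≟ suc i) (ρ i ≟ suc (ρ j))
    where
    1+ρ : ∀ {j} → j < n → suc (ρ j) ≡ n ∸ j
    1+ρ {j} j<n = sym (+-∸-assoc 1 j<n)
    to : j ≡ suc i → ρ i ≡ suc (ρ j)
    to refl = sym (1+ρ j<n)
    from : ρ i ≡ suc (ρ j) → j ≡ suc i
    from e = sym (∸-cancelˡ-≡ i<n (<⇒≤ j<n) (trans e (1+ρ j<n)))

  reversed : ∀ k → k < 18 → ∀ {e} → (∀ {i j} → i < n → j < n → e i j ≡ rule k (ρ j) (ρ i)) →
    Layout (mkGraph n e) (family k)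
  reversed k k<18 {e} e≡ = record
    { σ = ρ ; σ< = ρ< ; σ-involutive = ρ-involutive
    ; agrees = λ u v u≢v → agree (toℕ<n u) (toℕ<n v) (u≢v ∘ toℕ-injective) }
    where
    agree : ∀ {i j} → i < n → j < n → i ≢ j → symmetrise e i j ≡ family k (ρ i) (ρ j)
    agree {i} {j} i<n j<n i≢j with <-cmp i j
    ... | tri< i<j _ _ = trans (symmetrise-< e i<j) (trans (e≡ i<n j<n)
      (trans (rule-upper k k<18 (ρ-mono j<n i<j)) (family-sym k (ρ j) (ρ i))))
    ... | tri≈ _ i≡j _ = contradiction i≡j i≢j
    ... | tri> _ _ j<i = trans (symmetrise-> e j<i) (trans (e≡ j<n i<n)
      (rule-upper k k<18 (ρ-mono i<n j<i)))

layout : ∀ n → 7 ≤ n → ∀ k → 1 ≤ k → k ≤ 17 → Layout (H k n) (family k)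
layout n 7≤n k 1≤k k≤17 = go k 1≤k (s≤s k≤17)
  where
  open Reversal n
  <n : ∀ i → {True (i <? 7)} → i < n
  <n i {p} = <-≤-trans (toWitness p) 7≤n
  go : ∀ k → 1 ≤ k → k < 18 → Layout (H k n) (family k)
  -- `n ∸ 3` is `ρ 2`, so `i <ᵇ ρ 2` becomes `2 <ᵇ ρ i`; the other thresholds and the cases below
  -- are treated likewise.
  go 1 _ k< = reversed 1 k< λ i< j< → cong₂ _∨_ (ρ-<ᵇ i< (<n 2)) (cong₂ _∧_ (ρ-≡ᵇ i< (<n 2)) (ρ-≡ᵇ j< (<n 1)))
  go 2 _ k< = reversed 2 k< λ i< j< → ρ-<ᵇ i< (<n 2)
  go 3 _ k< = reversed 3 k< λ i< j< → cong₂ _∨_ (ρ-<ᵇ i< (<n 3))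
    (cong₂ _∨_ (ρ-suc i< j<) (cong₂ _∧_ (ρ-≡ᵇ i< (<n 3)) (ρ-≡ᵇ j< (<n 0))))
  go 4 _ k< = reversed 4 k< λ i< j< → cong₂ _∨_ (ρ-<ᵇ i< (<n 3)) (ρ-suc i< j<)
  go 5 _ k< = reversed 5 k< λ i< j< → cong₂ _∨_ (ρ-<ᵇ i< (<n 3))
    (cong₂ _∨_ (cong₂ _∧_ (ρ-≡ᵇ i< (<n 3)) (ρ-≡ᵇ j< (<n 2))) (cong₂ _∧_ (ρ-≡ᵇ i< (<n 1)) (ρ-≡ᵇ j< (<n 0))))
  go 6  _ k< = directly 6  k<
  go 7  _ k< = directly 7  k<
  go 8  _ k< = directly 8  k<
  go 9  _ k< = directly 9  k<
  go 10 _ k< = directly 10 k<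
  go 11 _ k< = directly 11 k<
  go 12 _ k< = directly 12 k<
  go 13 _ k< = directly 13 k<
  go 14 _ k< = directly 14 k<
  go 15 _ k< = directly 15 k<
  go 16 _ k< = directly 16 k<
  go 17 _ k< = directly 17 k<
  go (suc (suc (suc (suc (suc (suc (suc (suc (suc (suc (suc (suc (suc (suc (suc (suc (suc (suc k)))))))))))))))))) _ k< =
    contradiction k< (≤⇒≯ (m≤m+n 18 k))

-- Spanning embeddings and isomorphisms

module _ {n} {G K : Graph n} {F} (L : Layout K F) where

  open Layout L

  -- An embedding on all `n` indices is onto; its inverse followed by the involution gives the
  -- numbering of `K`.
  emb⇒≅ : Emb G n F → G ≅ K
  emb⇒≅ emb = mk↔ₛ′ to from to-from from-to , preserves
    where
    open Emb emb
    hit : ∀ v → ∃[ i ] (i < n × at i ≡ v)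
    hit = injBelow⇒surjective at at-inj ≤-refl
    pos : Fin n → ℕ
    pos v = proj₁ (hit v)
    pos< : ∀ v → pos v < n
    pos< v = proj₁ (proj₂ (hit v))
    at-pos : ∀ v → at (pos v) ≡ v
    at-pos v = proj₂ (proj₂ (hit v))
    to : Fin n → Fin n
    to v = fromℕ< (σ< (pos< v))
    from : Fin n → Fin n
    from v = at (σ (toℕ v))
    σ-to : ∀ v → σ (toℕ (to v)) ≡ pos v
    σ-to v = trans (cong σ (toℕ-fromℕ< _)) (σ-involutive (pos< v))
    from-to : ∀ v → from (to v) ≡ v
    from-to v = trans (cong at (σ-to v)) (at-pos v)
    to-from : ∀ v → to (from v) ≡ v
    to-from v = toℕ-injective (trans (toℕ-fromℕ< _) (trans
      (cong σ (at-inj (pos< _) (σ< (toℕ<n v)) (at-pos (from v)))) (σ-involutive (toℕ<n v))))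
    preserves : ∀ u v → E G u v ≡ E K (to u) (to v)
    preserves u v with u ≟ᶠ v
    ... | yes refl = trans (E-irrefl G u) (sym (E-irrefl K (to u)))
    ... | no u≢v = trans (sym (cong₂ (E G) (at-pos u) (at-pos v)))
      (trans (at-adj (pos< u) (pos< v) λ e → u≢v (trans (sym (at-pos u)) (trans (cong at e) (at-pos v))))
      (sym (trans (agrees (to u) (to v) λ e → u≢v (trans (sym (from-to u)) (trans (cong from e) (from-to v))))
        (cong₂ F (σ-to u) (σ-to v)))))

  ≅⇒emb : 0 < n → G ≅ K → Emb G n F
  ≅⇒emb 0<n (f , preserves) = record { at = at′ ; at-inj = at-inj′ ; at-adj = at-adj′ }
    where
    open Inverse f
    fin : ℕ → Fin n
    fin i with i <? n
    ... | yes i<n = fromℕ< i<n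
    -- A default for indices outside the graph.
    ... | no  _   = fromℕ< 0<n
    toℕ-fin : ∀ {i} → i < n → toℕ (fin i) ≡ i
    toℕ-fin {i} i<n with i <? n
    ... | yes i<n = toℕ-fromℕ< i<n
    ... | no i≮n  = contradiction i<n i≮n
    at′ : ℕ → Fin n
    at′ i = from (fin (σ i))
    σ-to-at : ∀ {i} → i < n → σ (toℕ (to (at′ i))) ≡ i
    σ-to-at i<n = trans (cong (σ ∘ toℕ) (strictlyInverseˡ _)) (trans (cong σ (toℕ-fin (σ< i<n))) (σ-involutive i<n))
    at-inj′ : InjBelow n at′
    at-inj′ i<n j<n e = trans (sym (σ-to-at i<n)) (trans (cong (σ ∘ toℕ ∘ to) e) (σ-to-at j<n))
    at-adj′ : ∀ {i j} → i < n → j < n → i ≢ j → E G (at′ i) (at′ j) ≡ F i j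
    at-adj′ i<n j<n i≢j = trans (preserves _ _)
      (trans (agrees _ _ λ e → i≢j (trans (sym (σ-to-at i<n)) (trans (cong (σ ∘ toℕ) e) (σ-to-at j<n))))
        (cong₂ F (σ-to-at i<n) (σ-to-at j<n)))

-- The classification

classification : ∀ {n} → 7 ≤ n → (G : Graph n) → Connected G → ¬ ResDomPartition G (n ∸ 3) →
  Emb G n complete ⊎ ∃[ k ] (k < 20 × Emb G n (families k))
classification {n} 7≤n G conn ¬n-3 =
  [ inj₁ , inj₂ ∘ from-path ]′ (complete-or-path G conn (below 2) (n ∸ 1) (m∸n+n≡m (below 1)) (s≤s z≤n) point)
  where
  below : ∀ m → {True (m ≤? 7)} → m ≤ n
  below m {p} = ≤-trans (toWitness p) 7≤n
  point : Emb G 1 complete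
  point = record
    { at = λ _ → fromℕ< (below 1) ; at-inj = λ { (s≤s z≤n) (s≤s z≤n) _ → refl }
    ; at-adj = λ { (s≤s z≤n) (s≤s z≤n) 0≢0 → contradiction refl 0≢0 } }
  grow : ∀ d {m} → d + m ≡ n → 7 ≤ m → ∃[ k ] (k < 20 × Emb G m (families k)) → ∃[ k ] (k < 20 × Emb G n (families k))
  grow zero    refl _   found = found
  grow (suc d) {m} e 7≤m found = grow d (trans (+-suc d m) e) (m≤n⇒m≤1+n 7≤m)
    (family-step G conn (below 2) ¬n-3 families-ok 7≤m (subst (m <_) e (s≤s (m≤n+m m d))) found)
  from-path : Emb G 3 (graphs level3 0) → ∃[ k ] (k < 20 × Emb G n (families k))
  from-path path = grow (n ∸ 7) (m∸n+n≡m 7≤n) ≤-refl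
    (level-step G conn (below 2) ¬n-3 level6-ok (s≤s (s≤s z≤n)) (below 7)
    (level-step G conn (below 2) ¬n-3 level5-ok (s≤s (s≤s z≤n)) (below 6)
    (level-step G conn (below 2) ¬n-3 level4-ok (s≤s (s≤s z≤n)) (below 5)
    (level-step G conn (below 2) ¬n-3 level3-ok (s≤s (s≤s z≤n)) (below 4)
    (0 , s≤s z≤n , path)))))

abstract
  -- Seven vertices suffice for all larger orders, since the first seven indices of an embedding
  -- carry the same relation.
  two-merges : ∀ k → k < 17 → Any (λ p → Certificate 7 2 (nth 0 p) (families k)) pairs7
  two-merges = toWitness {a? = all<? (λ k → Any.any? (λ p → certificate? 7 2 (nth 0 p) (families k)) pairs7) 17} _

  -- Cores of size 2, 3 and 4 leave n - 2, n - 3 and n - 4 twins in distinct classes. The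
  -- obstructions force none, one and two further classes, so the bound is n - 2 throughout.
  obstruction : ∀ k → k < 17 → core (suc k) ≡ 2 ⊎
    (core (suc k) ≡ 3 × Rigid 3 (families k)) ⊎ (core (suc k) ≡ 4 × Anchored 4 (families k))
  obstruction = toWitness {a? = all<? (λ k → (core (suc k) ≟ 2) ⊎-dec
    (((core (suc k) ≟ 3) ×-dec rigid? 3 (families k)) ⊎-dec
     ((core (suc k) ≟ 4) ×-dec anchored? 4 (families k)))) 17} _

  -- These indices are the families 18 to 20; n - 2 twins and a rigid core force more than n - 2
  -- classes.
  excess-rigid : ∀ k → k < 20 → 17 ≤ k → core (suc k) ≡ 2 × Rigid 2 (families k)
  excess-rigid = toWitness {a? = all<? (λ k → (17 ≤? k) →-dec
    ((core (suc k) ≟ 2) ×-dec rigid? 2 (families k))) 20} _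

core-clamped : ∀ k {c} → core (suc k) ≡ c → Clamped c (families k)
core-clamped k refl = blowUp-clamped (core (suc k)) (rule (suc k))

family-lower : ∀ {n} → 7 ≤ n → (G : Graph n) → ∀ k → k < 17 → Emb G n (families k) →
  ∀ l → l < n ∸ 2 → ¬ ResDomPartition G l
family-lower {n} 7≤n G k k<17 emb l l<n-2 (P , res , dom) with obstruction k k<17
... | inj₁ c≡2 = <⇒≱ l<n-2 (tail≤classes (core-clamped k c≡2) emb (≤-trans (m≤n+m 3 4) 7≤n) P res)
... | inj₂ (inj₁ (c≡3 , r)) =
  <⇒≱ l<n-2 (subst (_≤ l) (sym (+-∸-assoc 1 (≤-trans (m≤n+m 3 4) 7≤n)))
    (rigid-bound (core-clamped k c≡3) emb (≤-trans (m≤n+m 4 3) 7≤n) P res r dom))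
... | inj₂ (inj₂ (c≡4 , A)) =
  <⇒≱ l<n-2 (subst (_≤ l) (sym (+-∸-assoc 2 (≤-trans (m≤n+m 4 3) 7≤n)))
    (anchored-bound (core-clamped k c≡4) emb (≤-trans (m≤n+m 5 2) 7≤n) P res (s≤s z≤n) A))

family-upper : ∀ {n} → 7 ≤ n → (G : Graph n) → Connected G → ∀ k → k < 17 → Emb G n (families k) →
  ResDomPartition G (n ∸ 2)
family-upper 7≤n G conn k k<17 emb =
  certificate⇒resDom G conn (≤-trans (m≤n+m 2 5) 7≤n)
    (reindex id emb (λ i i<7 → <-≤-trans i<7 7≤n) (λ _ _ → id) λ _ _ _ → refl)
    (s≤s (s≤s z≤n)) (proj₂ (Any.satisfied (two-merges k k<17)))

mainTheorem3 : ∀ (n : ℕ) → 7 ≤ n → (G : Graph n) → Connected G →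
    (ηp≡ G (n ∸ 2) ⇔ (∃[ i ] (1 ≤ i × i ≤ 17 × G ≅ H i n)))
mainTheorem3 n 7≤n G conn = mk⇔ forward backward
  where
  2<n : 2 < n
  2<n = ≤-trans (m≤n+m 3 4) 7≤n
  forward : ηp≡ G (n ∸ 2) → ∃[ i ] (1 ≤ i × i ≤ 17 × G ≅ H i n)
  forward ((P , res , dom) , minimal) = [ complete-absurd , identify ]′
    (classification 7≤n G conn (minimal (n ∸ 3) (∸-monoʳ-< {n} {3} {2} (s≤s (s≤s (s≤s z≤n))) 2<n)))
    where
    -- In the complete graph the vertices from index 2 on are a clique of twins joined to vertex 0,
    -- so more than n - 2 classes are forced.
    complete-absurd : Emb G n complete → _
    complete-absurd emb = contradiction (rigid-bound {c = 2} (λ _ _ → refl) emb 2<n P res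
      (rigid 0 (s≤s z≤n) (inj₁ (refl , refl))) dom) (<-irrefl refl)
    identify : ∃[ k ] (k < 20 × Emb G n (families k)) → ∃[ i ] (1 ≤ i × i ≤ 17 × G ≅ H i n)
    identify (k , k<20 , emb) =
      [ (λ k<17 → suc k , s≤s z≤n , k<17 , emb⇒≅ (layout n 7≤n (suc k) (s≤s z≤n) k<17) emb)
      , (λ 17≤k → let c≡2 , r = excess-rigid k k<20 17≤k in
          contradiction (rigid-bound (core-clamped k c≡2) emb 2<n P res r dom) (<-irrefl refl))
      ]′ (<-≤-connex k 17)
  backward : ∃[ i ] (1 ≤ i × i ≤ 17 × G ≅ H i n) → ηp≡ G (n ∸ 2)
  backward (suc k , 1≤i , k<17 , G≅H) = family-upper 7≤n G conn k k<17 emb , family-lower 7≤n G k k<17 emb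
    where
    emb : Emb G n (families k)
    emb = ≅⇒emb (layout n 7≤n (suc k) 1≤i k<17) (≤-trans (s≤s z≤n) 2<n) G≅H
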